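{- There exists an integer $n_0$ such that for every $n\ge n_0$ divisible by $8$ there exist non-isomorphic graphs $G_n$ and $H_n$, each on $n$ vertices, such that $G_n\simeq_k H_n$ for every $k<\frac{1}{96}n-1$.
   Context: Graphs are finite, simple, undirected. For $k\ge1$, the $k$-dimensional Weisfeiler--Leman algorithm ($k$-WL) computes a stable coloring of $k$-tuples of vertices (for $k=1$: color refinement; for $k\ge2$: initial color of a tuple is the isomorphism type of the induced ordered subgraph, refined by the multiset over $w$ of the tuples of colors of the tuples obtained by replacing each single coordinate by $w$); colors are canonical across graphs. $G\simeq_k H$ means $k$-WL does not distinguish $G$ and $H$, i.e., the multisets of stable colors of all $k$-tuples of $G$ and of $H$ coincide. -}

module Defs where

open import Data.Nat using (ℕ; zero; suc)
open import Data.Fin using (Fin)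
open import Data.Bool using (Bool; false; T)
open import Data.Vec using (Vec; lookup; _[_]≔_)
open import Data.Product using (Σ; _×_; proj₁)
open import Data.Unit using (⊤)
open import Function.Bundles using (_↔_; _⇔_; Inverse)
open import Relation.Binary.PropositionalEquality using (_≡_)

record Graph (n : ℕ) : Set where
  field
    adj    : Fin n → Fin n → Bool
    sym    : ∀ u v → adj u v ≡ adj v u
    irrefl : ∀ v → adj v v ≡ false
open Graph public

Iso : {n : ℕ} → Graph n → Graph n → Set
Iso {n} G H = Σ (Fin n ↔ Fin n) λ f →
  ∀ u v → adj H (Inverse.to f u) (Inverse.to f v) ≡ adj G u v

Nbr : {n : ℕ} → Graph n → Fin n → Set
Nbr {n} G v = Σ (Fin n) λ w → T (adj G v w)

-- Colour refinement (1-WL), run jointly on G and H with canonical colours: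
-- sameCR G H r v u  means  v in G and u in H get the same colour after r rounds.
-- Round r+1 colour = (round r colour, multiset of round r colours of neighbours);
-- equality of multisets = a bijection between the neighbourhoods preserving colours.
sameCR : {n : ℕ} → Graph n → Graph n → ℕ → Fin n → Fin n → Set
sameCR G H zero    v u = ⊤
sameCR G H (suc r) v u = sameCR G H r v u ×
  Σ (Nbr G v ↔ Nbr H u) λ π →
    ∀ x → sameCR G H r (proj₁ x) (proj₁ (Inverse.to π x))

AtpEq : {n k : ℕ} → Graph n → Graph n → Vec (Fin n) k → Vec (Fin n) k → Set
AtpEq {n} {k} G H a b = ∀ (i j : Fin k) →
  ((lookup a i ≡ lookup a j) ⇔ (lookup b i ≡ lookup b j)) ×
  (adj G (lookup a i) (lookup a j) ≡ adj H (lookup b i) (lookup b j))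

-- k-WL (k ≥ 2), run jointly with canonical colours:
-- sameWL G H r a b  means  tuple a of G and tuple b of H have the same colour after r rounds.
-- Round r+1 colour = (round r colour, multiset over w of the k-tuple of round r colours
-- of a[1/w], ..., a[k/w]); multiset equality = a bijection of the w's preserving it.
sameWL : {n k : ℕ} → Graph n → Graph n → ℕ → Vec (Fin n) k → Vec (Fin n) k → Set
sameWL G H zero    a b = AtpEq G H a b
sameWL {n} {k} G H (suc r) a b = sameWL G H r a b ×
  Σ (Fin n ↔ Fin n) λ π →
    ∀ (w : Fin n) (i : Fin k) → sameWL G H r (a [ i ]≔ w) (b [ i ]≔ Inverse.to π w)

-- G ≃_k H : for every round r, the multisets of round-r colours of all k-tuples
-- of G and of H coincide (equivalently: the multisets of stable colours coincide).
WLEquiv : {n : ℕ} → ℕ → Graph n → Graph n → Set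
WLEquiv zero G H = ⊤
WLEquiv {n} (suc zero) G H = ∀ (r : ℕ) →
  Σ (Fin n ↔ Fin n) λ σ → ∀ v → sameCR G H r v (Inverse.to σ v)
WLEquiv {n} (suc (suc m)) G H = ∀ (r : ℕ) →
  Σ (Vec (Fin n) (suc (suc m)) ↔ Vec (Fin n) (suc (suc m))) λ σ →
    ∀ a → sameWL G H r a (Inverse.to σ a)

{-# OPTIONS --safe #-}
-- Write n = 8M and let the base graph be a bipartite cubic multigraph on 2M nodes, the union of
-- three perfect matchings. The graphs G and H are Cai–Fürer–Immerman graphs over it in which two
-- vertices over different nodes are adjacent unless they disagree on a common edge: H carries one
-- odd charge, so only G has a clique meeting the fibre of every node.
--
-- For WL equivalence, Duplicator keeps the odd charge in the component of the base graph minus the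
-- pebbled nodes X that has more than M nodes. If no such component existed, a union of components
-- would contain between 1/3 and 2/3 of all nodes; putting each x ∈ X on the side of the majority of
-- its neighbours turns it into a cut with at most |X| < M/12 edges and both sides still large.
--
-- Matchings without such cuts exist by a first moment argument. A random permutation maps S onto
-- each set of size s with probability 1/C(M,s), and there are at most (32 (33/32)³⁶)^(M/12) < 97^(M/12)
-- ways to choose fewer than M/12 of the 3M edges, whereas C(M,s) ≥ 220^⌊M/12⌋ when M/4 ≤ s ≤ 3M/4.
module Submission where

open import Defs hiding (sym)
open import Algebra.Bundles using (CommutativeRing)
import Algebra.Properties.CommutativeMonoid.Sum as Sum
open import Data.Bool using (Bool; true; false; if_then_else_; not; _xor_; _∧_; _∨_; T)
import Data.Bool.Properties as Bool
open import Data.Bool.Properties using (xor-comm; xor-same; xor-identityʳ; xor-∧-commutativeRing)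
open import Data.Empty using (⊥)
open import Data.Fin using (Fin; zero; suc; punchIn; punchOut)
open import Data.Fin.Patterns using (0F; 1F; 2F)
open import Data.Fin.Permutation using (Permutation′; _⟨$⟩ʳ_; _⟨$⟩ˡ_; inverseˡ; inverseʳ; insert; insert-punchIn) renaming (id to idₚ)
import Data.Fin.Properties as Fin
open import Data.Fin.Subset.Properties using (anySubset?)
open import Data.List using (List; []; _∷_; _++_; map; allFin; cartesianProduct; length)
open import Data.List.Membership.Propositional using (_∈_; _∉_)
open import Data.List.Membership.Propositional.Properties using (∈-++⁺ˡ; ∈-++⁺ʳ; ∈-map⁺; ∈-allFin)
open import Data.List.Properties using (length-++; length-map; length-tabulate; map-tabulate)
open import Data.List.Relation.Binary.Subset.Propositional using (_⊆_)
open import Data.List.Relation.Unary.All as All using (All; []; _∷_)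
open import Data.List.Relation.Unary.All.Properties using (anti-mono)
open import Data.List.Relation.Unary.Any using (here; there)
open import Data.Nat hiding (_≟_; equal)
open import Data.Nat.Divisibility using (_∣_; divides)
open import Data.Nat.DivMod using (_/_; _%_; m≡m%n+[m/n]*n; m%n<n; /-monoˡ-≤)
open import Data.Nat.Properties hiding (_≟_)
open import Data.Nat.Tactic.RingSolver using (solve-∀)
open import Data.Product using (Σ; ∃; _×_; _,_; proj₁; proj₂)
open import Data.Product.Function.NonDependent.Propositional using (_×-↔_)
open import Data.Product.Properties using (≡-dec)
open import Data.Sum using (inj₁; inj₂)
open import Data.Unit using (⊤; tt)
import Data.Vec as Vec
open import Data.Vec using (Vec; []; _∷_; lookup; tabulate; toList; insertAt; removeAt; _[_]≔_)
open import Data.Vec.Properties using (lookup∘tabulate; tabulate∘lookup; tabulate-cong; map-[]≔; map-cong; map-∘; map-id; lookup-map; length-toList)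
open import Function using (_∘_; id)
open import Function.Bundles using (_↔_; Inverse; mk↔ₛ′; mk⇔)
open import Function.Construct.Composition using (_↔-∘_)
open import Function.Construct.Identity using (↔-id)
open import Function.Construct.Symmetry using (↔-sym)
open import Function.Definitions using (Injective)
open import Relation.Binary.Definitions using (DecidableEquality)
open import Relation.Binary.PropositionalEquality using (_≡_; _≢_; refl; sym; trans; cong; cong₂; subst; module ≡-Reasoning)
open import Relation.Nullary using (yes; no; does; ¬_; contradiction; Dec)
open import Relation.Nullary.Decidable using (toWitness; dec-true; dec-false; _×-dec_; _⊎-dec_; map′; does-⇔)

-- After relabelling, one matching is the identity and only two are random. Each random matching
-- contributes a factor 1/C(M,s) for a left set `S` of size s. One of the two makes the sum over all
-- `S` harmless, since 1/C(M,s) summed over all `S` is only M + 1; the other is left to beat the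
-- number of small edge sets. With a single random matching nothing would remain for the edges.
--
-- Components and paths are replaced by mod-2 chains of edges. Duplicator only needs a set of edges
-- with a prescribed boundary, the same boundary operator gives the parity argument against
-- isomorphism, and being linked becomes decidable because there are finitely many chains.
--
-- The constant 96 is 8 · 12: there are 8M vertices, and a big component exists while fewer than
-- M/12 nodes are occupied. The bound on k has k + 1 because the k pebbles and the vertex being
-- placed must be handled together.

private variable
  A B : Set

+-interchange : ∀ a b c d → a + b + (c + d) ≡ a + c + (b + d)
+-interchange = solve-∀

+-interchange₃ : ∀ a b c x y z → a + x + (b + y) + (c + z) ≡ a + b + c + (x + y + z)
+-interchange₃ = solve-∀

+-exchange : ∀ k l m → k + (l + m) ≡ l + (k + m)
+-exchange = solve-∀

-- Finite sums over lists.

∑ : List A → (A → ℕ) → ℕ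
∑ []       f = 0
∑ (x ∷ xs) f = f x + ∑ xs f

∑-mono : (xs : List A) {f g : A → ℕ} → (∀ x → f x ≤ g x) → ∑ xs f ≤ ∑ xs g
∑-mono []       f≤g = z≤n
∑-mono (x ∷ xs) f≤g = +-mono-≤ (f≤g x) (∑-mono xs f≤g)

∑-cong : (xs : List A) {f g : A → ℕ} → (∀ x → f x ≡ g x) → ∑ xs f ≡ ∑ xs g
∑-cong []       f≡g = refl
∑-cong (x ∷ xs) f≡g = cong₂ _+_ (f≡g x) (∑-cong xs f≡g)

∑-distrib-+ : (xs : List A) (f g : A → ℕ) → ∑ xs (λ x → f x + g x) ≡ ∑ xs f + ∑ xs g
∑-distrib-+ []       f g = refl
∑-distrib-+ (x ∷ xs) f g = trans (cong (f x + g x +_) (∑-distrib-+ xs f g))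
  (+-interchange (f x) (g x) (∑ xs f) (∑ xs g))

∑-*ˡ : (xs : List A) (c : ℕ) (f : A → ℕ) → ∑ xs (λ x → c * f x) ≡ c * ∑ xs f
∑-*ˡ []       c f = sym (*-zeroʳ c)
∑-*ˡ (x ∷ xs) c f = trans (cong (c * f x +_) (∑-*ˡ xs c f)) (sym (*-distribˡ-+ c (f x) (∑ xs f)))

∑-*ʳ : (xs : List A) (f : A → ℕ) (c : ℕ) → ∑ xs (λ x → f x * c) ≡ ∑ xs f * c
∑-*ʳ xs f c = trans (∑-cong xs (λ x → *-comm (f x) c)) (trans (∑-*ˡ xs c f) (*-comm c (∑ xs f)))

∑-zero : (xs : List A) → ∑ xs (λ _ → 0) ≡ 0
∑-zero []       = refl
∑-zero (_ ∷ xs) = ∑-zero xs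

∑-swap : (xs : List A) (ys : List B) (f : A → B → ℕ) →
         ∑ xs (λ x → ∑ ys (f x)) ≡ ∑ ys (λ y → ∑ xs (λ x → f x y))
∑-swap []       ys f = sym (∑-zero ys)
∑-swap (x ∷ xs) ys f = trans (cong (∑ ys (f x) +_) (∑-swap xs ys f))
  (sym (∑-distrib-+ ys (f x) (λ y → ∑ xs (λ x → f x y))))

∑-++ : (xs ys : List A) (f : A → ℕ) → ∑ (xs ++ ys) f ≡ ∑ xs f + ∑ ys f
∑-++ []       ys f = refl
∑-++ (x ∷ xs) ys f = trans (cong (f x +_) (∑-++ xs ys f)) (sym (+-assoc (f x) _ _))

∑-map : (g : A → B) (xs : List A) (f : B → ℕ) → ∑ (map g xs) f ≡ ∑ xs (f ∘ g)
∑-map g []       f = refl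
∑-map g (x ∷ xs) f = cong (f (g x) +_) (∑-map g xs f)

∑-× : (xs : List A) (ys : List B) (f : A × B → ℕ) →
      ∑ (cartesianProduct xs ys) f ≡ ∑ xs (λ x → ∑ ys (λ y → f (x , y)))
∑-× []       ys f = refl
∑-× (x ∷ xs) ys f = trans (∑-++ (map (x ,_) ys) _ f)
  (cong₂ _+_ (∑-map (x ,_) ys f) (∑-× xs ys f))

∑-∈ : {x : A} {xs : List A} (f : A → ℕ) → x ∈ xs → f x ≤ ∑ xs f
∑-∈ f (here refl) = m≤m+n _ _
∑-∈ f (there x∈)  = ≤-trans (∑-∈ f x∈) (m≤n+m _ _)

∑-average : (xs : List A) (f : A → ℕ) (c : ℕ) → ∑ xs f < length xs * c → ∃ λ x → f x < c
∑-average (x ∷ xs) f c lt with f x <? c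
... | yes fx<c = x , fx<c
... | no  fx≮c = ∑-average xs f c (+-cancelˡ-< c _ _ (≤-<-trans (+-monoˡ-≤ _ (≮⇒≥ fx≮c)) lt))

∑-allFin-suc : ∀ n (f : Fin (suc n) → ℕ) → ∑ (allFin (suc n)) f ≡ f zero + ∑ (allFin n) (f ∘ suc)
∑-allFin-suc n f = cong (f zero +_)
  (trans (cong (λ xs → ∑ xs f) (sym (map-tabulate id suc))) (∑-map suc (allFin n) f))

-- Subsets as bit vectors, and permutations listed by codes.

subsets : ∀ n → List (Vec Bool n)
subsets zero    = [] ∷ []
subsets (suc n) = map (true ∷_) (subsets n) ++ map (false ∷_) (subsets n)

∈-subsets : ∀ {n} (S : Vec Bool n) → S ∈ subsets n
∈-subsets []          = here refl
∈-subsets (true ∷ S)  = ∈-++⁺ˡ (∈-map⁺ (true ∷_) (∈-subsets S))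
∈-subsets (false ∷ S) = ∈-++⁺ʳ _ (∈-map⁺ (false ∷_) (∈-subsets S))

∑-subsets-suc : ∀ n (f : Vec Bool (suc n) → ℕ) →
  ∑ (subsets (suc n)) f ≡ ∑ (subsets n) (f ∘ (true ∷_)) + ∑ (subsets n) (f ∘ (false ∷_))
∑-subsets-suc n f = trans (∑-++ (map (true ∷_) (subsets n)) _ f)
  (cong₂ _+_ (∑-map _ (subsets n) f) (∑-map _ (subsets n) f))

-- Lehmer codes: (j , c) sends 0 to j and the remaining points to the remaining points by c.
Code : ℕ → Set
Code zero    = ⊤
Code (suc n) = Fin (suc n) × Code n

codes : ∀ n → List (Code n)
codes zero    = tt ∷ []
codes (suc n) = cartesianProduct (allFin (suc n)) (codes n)

length-cartesianProduct : (xs : List A) (ys : List B) → length (cartesianProduct xs ys) ≡ length xs * length ys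
length-cartesianProduct []       ys = refl
length-cartesianProduct (x ∷ xs) ys = trans (length-++ (map (x ,_) ys))
  (cong₂ _+_ (length-map (x ,_) ys) (length-cartesianProduct xs ys))

length-codes : ∀ n → length (codes n) ≡ n !
length-codes zero    = refl
length-codes (suc n) = trans (length-cartesianProduct (allFin (suc n)) (codes n))
  (cong₂ _*_ (length-tabulate {n = suc n} id) (length-codes n))

perm : ∀ {n} → Code n → Permutation′ n
perm {zero}  _       = idₚ
perm {suc n} (j , c) = insert zero j (perm c)

-- Pushes a set forward along `perm c`. Working on the code lets sums over `codes` unfold by the
-- same recursion; `preimage` is the pull-back.
image : ∀ {n} → Code n → Vec Bool n → Vec Bool n
image {zero}  _       []      = []
image {suc n} (j , c) (b ∷ S) = insertAt (image c S) j b

preimage : ∀ {n} → Code n → Vec Bool n → Vec Bool n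
preimage {zero}  _       _ = []
preimage {suc n} (j , c) R = lookup R j ∷ preimage c (removeAt R j)

lookup-removeAt : ∀ {n} (R : Vec A (suc n)) j i → lookup (removeAt R j) i ≡ lookup R (punchIn j i)
lookup-removeAt (x ∷ R)     zero    i       = refl
lookup-removeAt (x ∷ y ∷ R) (suc j) zero    = refl
lookup-removeAt (x ∷ y ∷ R) (suc j) (suc i) = lookup-removeAt (y ∷ R) j i

lookup-preimage : ∀ {n} (c : Code n) R i → lookup (preimage c R) i ≡ lookup R (perm c ⟨$⟩ʳ i)
lookup-preimage {suc n} (j , c) R zero    = refl
lookup-preimage {suc n} (j , c) R (suc i) = begin
  lookup (preimage c (removeAt R j)) i        ≡⟨ lookup-preimage c (removeAt R j) i ⟩
  lookup (removeAt R j) (perm c ⟨$⟩ʳ i)       ≡⟨ lookup-removeAt R j _ ⟩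
  lookup R (punchIn j (perm c ⟨$⟩ʳ i))        ≡⟨ cong (lookup R) (insert-punchIn zero j (perm c) i) ⟨
  lookup R (insert zero j (perm c) ⟨$⟩ʳ suc i) ∎
  where open ≡-Reasoning

[_≠_] : Bool → Bool → ℕ
[ a ≠ b ] = if a xor b then 1 else 0

[_≐_] : Bool → Bool → ℕ
[ a ≐ b ] = if a xor b then 0 else 1

ham agree : ∀ {n} → Vec Bool n → Vec Bool n → ℕ
ham []      []      = 0
ham (a ∷ S) (b ∷ R) = [ a ≠ b ] + ham S R
agree []      []      = 0
agree (a ∷ S) (b ∷ R) = [ a ≐ b ] + agree S R

agree+ham : ∀ {n} (S R : Vec Bool n) → agree S R + ham S R ≡ n
agree+ham []      []      = refl
agree+ham (a ∷ S) (b ∷ R) with a xor b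
... | true  = trans (+-suc _ _) (cong suc (agree+ham S R))
... | false = cong suc (agree+ham S R)

ham-insertAt : ∀ {n} (S : Vec Bool n) j b R → ham (insertAt S j b) R ≡ [ b ≠ lookup R j ] + ham S (removeAt R j)
ham-insertAt S       zero    b (x ∷ R)     = refl
ham-insertAt (a ∷ S) (suc j) b (x ∷ y ∷ R) =
  trans (cong ([ a ≠ x ] +_) (ham-insertAt S j b (y ∷ R))) (+-exchange [ a ≠ x ] [ b ≠ lookup (y ∷ R) j ] _)

-- Relabelling both sets does not change their distance. The left form is the one averaged over
-- random `c`, the right form is the one that counts cut edges.
ham-image : ∀ {n} (c : Code n) S R → ham (image c S) R ≡ ham S (preimage c R)
ham-image {zero}  _       []      []  = refl
ham-image {suc n} (j , c) (b ∷ S) R =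
  trans (ham-insertAt (image c S) j b R) (cong ([ b ≠ lookup R j ] +_) (ham-image c S (removeAt R j)))

count : ∀ {n} → Bool → Vec Bool n → ℕ
count b []      = 0
count b (a ∷ S) = [ b ≐ a ] + count b S

count-total : ∀ {n} (S : Vec Bool n) → count true S + count false S ≡ n
count-total []          = refl
count-total (true ∷ S)  = cong suc (count-total S)
count-total (false ∷ S) = trans (+-suc _ _) (cong suc (count-total S))

count-insertAt : ∀ {n} a (S : Vec Bool n) j b → count a (insertAt S j b) ≡ [ a ≐ b ] + count a S
count-insertAt a S       zero    b = refl
count-insertAt a (x ∷ S) (suc j) b = trans (cong ([ a ≐ x ] +_) (count-insertAt a S j b)) (+-exchange [ a ≐ x ] [ a ≐ b ] _)

-- Double counting: a vector `S` arises by inserting `b` at position `j` exactly once for each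
-- position where `S` has the bit `b`.
∑-insertAt : ∀ n b (f : Vec Bool (suc n) → ℕ) →
  ∑ (allFin (suc n)) (λ j → ∑ (subsets n) (λ S → f (insertAt S j b))) ≡
  ∑ (subsets (suc n)) (λ S → count b S * f S)
∑-insertAt zero true  f = refl
∑-insertAt zero false f = refl
∑-insertAt (suc n) b f = begin
  ∑ (allFin (suc (suc n))) (λ j → ∑ (subsets (suc n)) (λ S → f (insertAt S j b)))
    ≡⟨ ∑-allFin-suc (suc n) (λ j → ∑ (subsets (suc n)) (λ S → f (insertAt S j b))) ⟩
  ∑ (subsets (suc n)) (f ∘ (b ∷_)) + ∑ (allFin (suc n)) (λ j → ∑ (subsets (suc n)) (λ S → f (insertAt S (suc j) b)))
    ≡⟨ cong (∑ (subsets (suc n)) (f ∘ (b ∷_)) +_) (begin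
       _ ≡⟨ ∑-cong (allFin (suc n)) (λ j → ∑-subsets-suc n _) ⟩
       ∑ (allFin (suc n)) (λ j → part true j + part false j)
         ≡⟨ ∑-distrib-+ (allFin (suc n)) (part true) (part false) ⟩
       ∑ (allFin (suc n)) (part true) + ∑ (allFin (suc n)) (part false)
         ≡⟨ cong₂ _+_ (∑-insertAt n b (f ∘ (true ∷_))) (∑-insertAt n b (f ∘ (false ∷_))) ⟩
       rest true + rest false ∎) ⟩
  ∑ (subsets (suc n)) (f ∘ (b ∷_)) + (rest true + rest false)
    ≡⟨ final b ⟩
  all true + all false
    ≡⟨ ∑-subsets-suc (suc n) _ ⟨
  ∑ (subsets (suc (suc n))) (λ S → count b S * f S) ∎
  where
  open ≡-Reasoning
  part : Bool → Fin (suc n) → ℕ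
  part a j = ∑ (subsets n) (λ S → f (a ∷ insertAt S j b))
  rest all : Bool → ℕ
  rest a = ∑ (subsets (suc n)) (λ S → count b S * f (a ∷ S))
  all  a = ∑ (subsets (suc n)) (λ S → ([ b ≐ a ] + count b S) * f (a ∷ S))
  final : ∀ a → ∑ (subsets (suc n)) (f ∘ (a ∷_)) + (rest true + rest false) ≡
    ∑ (subsets (suc n)) (λ S → ([ a ≐ true ] + count b S) * f (true ∷ S)) +
    ∑ (subsets (suc n)) (λ S → ([ a ≐ false ] + count b S) * f (false ∷ S))
  final true  = trans (sym (+-assoc _ (rest true) (rest false)))
    (cong (_+ rest false) (sym (∑-distrib-+ (subsets (suc n)) _ _)))
  final false = trans (+-exchange _ (rest true) (rest false))
    (cong (rest true +_) (sym (∑-distrib-+ (subsets (suc n)) _ _)))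

-- Averages over all permutations.

δ : ℕ → ℕ → ℕ
δ zero    zero    = 1
δ zero    (suc n) = 0
δ (suc m) zero    = 0
δ (suc m) (suc n) = δ m n

δ≤1 : ∀ m n → δ m n ≤ 1
δ≤1 zero    zero    = ≤-refl
δ≤1 zero    (suc n) = z≤n
δ≤1 (suc m) zero    = z≤n
δ≤1 (suc m) (suc n) = δ≤1 m n

δ-subst : ∀ (P : ℕ → ℕ) m n → P m * δ m n ≡ P n * δ m n
δ-subst P zero    zero    = refl
δ-subst P zero    (suc n) = trans (*-zeroʳ (P 0)) (sym (*-zeroʳ (P (suc n))))
δ-subst P (suc m) zero    = trans (*-zeroʳ (P (suc m))) (sym (*-zeroʳ (P 0)))
δ-subst P (suc m) (suc n) = δ-subst (P ∘ suc) m n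

-- The number of permutations carrying `S` onto a fixed set of the same size; divided by n! it is
-- the inverse of a binomial coefficient.
orders : ∀ {n} → Vec Bool n → ℕ
orders S = count true S ! * count false S !

-- A uniformly random permutation maps S onto each set of the same size with the same probability.
∑-image : ∀ {n} (S : Vec Bool n) (h : Vec Bool n → ℕ) →
  ∑ (codes n) (λ c → h (image c S)) ≡
  orders S * ∑ (subsets n) (λ T → δ (count true T) (count true S) * h T)
∑-image []      h = base (h [])
  where
  base : ∀ x → x + 0 ≡ 1 * (1 * x + 0)
  base = solve-∀
∑-image {suc n} (b ∷ S) h = begin
  ∑ (codes (suc n)) (λ c → h (image c (b ∷ S)))
    ≡⟨ ∑-× (allFin (suc n)) (codes n) _ ⟩
  ∑ (allFin (suc n)) (λ j → ∑ (codes n) (λ c → h (insertAt (image c S) j b)))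
    ≡⟨ ∑-cong (allFin (suc n)) (λ j → ∑-image S (λ T → h (insertAt T j b))) ⟩
  ∑ (allFin (suc n)) (λ j → orders S * ∑ (subsets n) (λ T → δ (count true T) (count true S) * h (insertAt T j b)))
    ≡⟨ ∑-*ˡ (allFin (suc n)) (orders S) _ ⟩
  orders S * ∑ (allFin (suc n)) (λ j → ∑ (subsets n) (λ T → δ (count true T) (count true S) * h (insertAt T j b)))
    ≡⟨ cong (orders S *_) (∑-cong (allFin (suc n)) (λ j → ∑-cong (subsets n) (λ T →
         cong (_* h (insertAt T j b)) (δ-insertAt T j)))) ⟩
  orders S * ∑ (allFin (suc n)) (λ j → ∑ (subsets n) (λ T → k (insertAt T j b)))
    ≡⟨ cong (orders S *_) (∑-insertAt n b k) ⟩
  orders S * ∑ (subsets (suc n)) (λ T → count b T * k T)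
    -- Where the δ inside `k` is nonzero, `T` contains the bit `b` as often as `b ∷ S` does, so the
    -- count is a constant factor.
    ≡⟨ cong (orders S *_) (trans (∑-cong (subsets (suc n)) size) (∑-*ˡ (subsets (suc n)) (count b (b ∷ S)) k)) ⟩
  orders S * (count b (b ∷ S) * ∑ (subsets (suc n)) k)
    ≡⟨ *-assoc (orders S) _ _ ⟨
  orders S * count b (b ∷ S) * ∑ (subsets (suc n)) k
    ≡⟨ cong (_* ∑ (subsets (suc n)) k) (orders-∷ b) ⟩
  orders (b ∷ S) * ∑ (subsets (suc n)) k ∎
  where
  open ≡-Reasoning
  k : Vec Bool (suc n) → ℕ
  k T = δ (count true T) (count true (b ∷ S)) * h T
  δ-+ : ∀ a m n → δ m n ≡ δ (a + m) (a + n)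
  δ-+ zero    m n = refl
  δ-+ (suc a) m n = δ-+ a m n
  δ-insertAt : ∀ T j → δ (count true T) (count true S) ≡ δ (count true (insertAt T j b)) (count true (b ∷ S))
  δ-insertAt T j = trans (δ-+ [ true ≐ b ] _ _) (cong (λ x → δ x (count true (b ∷ S))) (sym (count-insertAt true T j b)))
  count-via : ∀ (T : Vec Bool (suc n)) → count false T ≡ suc n ∸ count true T
  count-via T = trans (sym (m+n∸m≡n (count true T) (count false T))) (cong (_∸ count true T) (count-total T))
  size′ : ∀ b (U T : Vec Bool (suc n)) → count b T * δ (count true T) (count true U) ≡ count b U * δ (count true T) (count true U)
  size′ true  U T = δ-subst id (count true T) (count true U)
  size′ false U T rewrite count-via T | count-via U = δ-subst (suc n ∸_) (count true T) (count true U)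
  size : ∀ T → count b T * k T ≡ count b (b ∷ S) * k T
  size T = trans (sym (*-assoc (count b T) _ (h T))) (trans (cong (_* h T) (size′ b (b ∷ S) T)) (*-assoc (count b (b ∷ S)) _ (h T)))
  orders-∷ : ∀ b → orders S * count b (b ∷ S) ≡ orders (b ∷ S)
  orders-∷ true  = swapˡ (count true S !) (count false S !) (suc (count true S))
    where
    swapˡ : ∀ x y z → x * y * z ≡ z * x * y
    swapˡ = solve-∀
  orders-∷ false = swapʳ (count true S !) (count false S !) (suc (count false S))
    where
    swapʳ : ∀ x y z → x * y * z ≡ x * (z * y)
    swapʳ = solve-∀

-- Forgetting that the image has the size of `S` lets the sum run over all subsets, where `∑-weight`
-- has a closed form.
∑-image-≤ : ∀ {n} (S : Vec Bool n) (h : Vec Bool n → ℕ) →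
  ∑ (codes n) (λ c → h (image c S)) ≤ orders S * ∑ (subsets n) h
∑-image-≤ {n} S h = ≤-trans (≤-reflexive (∑-image S h)) (*-monoʳ-≤ (orders S) (∑-mono (subsets n) λ T →
  ≤-trans (*-monoˡ-≤ (h T) (δ≤1 (count true T) (count true S))) (≤-reflexive (*-identityˡ (h T)))))

-- This is the Beta integral of x^a (1-x)^b (x + (1-x))^n, expanded over the n factors. The shifts
-- `a` and `b` absorb the first bit of `S`, so that the induction on `n` closes.
∑-orders-shifted : ∀ n a b →
  (suc (a + b)) ! * ∑ (subsets n) (λ S → (count true S + a) ! * (count false S + b) !) ≡
  a ! * b ! * (suc (a + b + n)) !
∑-orders-shifted zero a b rewrite +-identityʳ (a + b) = base ((suc (a + b)) !) (a !) (b !)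
  where
  base : ∀ x y z → x * (y * z + 0) ≡ y * z * x
  base = solve-∀
-- The extra factor turns the leading factorial into the one that both instances of the induction
-- hypothesis carry.
∑-orders-shifted (suc n) a b = *-cancelˡ-≡ _ _ (suc (suc (a + b))) (begin
  suc (suc (a + b)) * (suc (a + b) ! * ∑ (subsets (suc n)) f)
    ≡⟨ *-assoc (suc (suc (a + b))) (suc (a + b) !) _ ⟨
  suc (suc (a + b)) ! * ∑ (subsets (suc n)) f
    ≡⟨ cong (suc (suc (a + b)) ! *_) (trans (∑-subsets-suc n f) (cong₂ _+_
         (∑-cong (subsets n) (λ S → cong (λ x → x ! * (count false S + b) !) (sym (+-suc (count true S) a))))
         (∑-cong (subsets n) (λ S → cong (λ x → (count true S + a) ! * x !) (sym (+-suc (count false S) b)))))) ⟩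
  suc (suc (a + b)) ! * (∑ (subsets n) (g (suc a) b) + ∑ (subsets n) (g a (suc b)))
    ≡⟨ *-distribˡ-+ (suc (suc (a + b)) !) (∑ (subsets n) (g (suc a) b)) (∑ (subsets n) (g a (suc b))) ⟩
  suc (suc (a + b)) ! * ∑ (subsets n) (g (suc a) b) + suc (suc (a + b)) ! * ∑ (subsets n) (g a (suc b))
    ≡⟨ cong₂ _+_ (∑-orders-shifted n (suc a) b)
         (trans (cong (λ x → suc x ! * ∑ (subsets n) (g a (suc b))) (sym (+-suc a b))) (∑-orders-shifted n a (suc b))) ⟩
  suc a ! * b ! * suc (suc (a + b + n)) ! + a ! * suc b ! * suc (a + suc b + n) !
    ≡⟨ cong₂ (λ x y → suc a ! * b ! * suc x ! + a ! * suc b ! * suc y !) (sym (+-suc (a + b) n))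
         (trans (cong (_+ n) (+-suc a b)) (sym (+-suc (a + b) n))) ⟩
  suc a ! * b ! * suc (a + b + suc n) ! + a ! * suc b ! * suc (a + b + suc n) !
    ≡⟨ combine a b (a !) (b !) (suc (a + b + suc n) !) ⟩
  suc (suc (a + b)) * (a ! * b ! * suc (a + b + suc n) !) ∎)
  where
  open ≡-Reasoning
  g : ℕ → ℕ → Vec Bool n → ℕ
  g a b S = (count true S + a) ! * (count false S + b) !
  f : Vec Bool (suc n) → ℕ
  f S = (count true S + a) ! * (count false S + b) !
  combine : ∀ a b x y z → suc a * x * y * z + x * (suc b * y) * z ≡ suc (suc (a + b)) * (x * y * z)
  combine = solve-∀

-- After division by n!: the inverse binomials sum to 1 over the sets of each fixed size, and there
-- are n + 1 sizes.
∑-orders : ∀ n → ∑ (subsets n) orders ≡ suc n !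
∑-orders n = begin
  ∑ (subsets n) orders
    ≡⟨ ∑-cong (subsets n) (λ S → cong₂ (λ x y → x ! * y !) (sym (+-identityʳ (count true S))) (sym (+-identityʳ (count false S)))) ⟩
  ∑ (subsets n) (λ S → (count true S + 0) ! * (count false S + 0) !)
    ≡⟨ *-identityˡ _ ⟨
  1 * ∑ (subsets n) (λ S → (count true S + 0) ! * (count false S + 0) !)
    ≡⟨ ∑-orders-shifted n 0 0 ⟩
  1 * suc n !
    ≡⟨ *-identityˡ _ ⟩
  suc n ! ∎
  where open ≡-Reasoning

-- The binomial coefficient (a + b choose a), as a number of lattice paths.
paths : ℕ → ℕ → ℕ
paths zero    b       = 1
paths (suc a) zero    = 1
paths (suc a) (suc b) = paths a (suc b) + paths (suc a) b

paths-! : ∀ a b → paths a b * (a ! * b !) ≡ (a + b) !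
paths-! zero    b    = trans (*-identityˡ _) (*-identityˡ (b !))
paths-! (suc a) zero = trans (*-identityˡ _) (trans (*-identityʳ _) (cong (λ x → suc x !) (sym (+-identityʳ a))))
paths-! (suc a) (suc b) = begin
  (p + r) * (suc a * a ! * (suc b * b !))
    ≡⟨ split p r (suc a) (suc b) (a !) (b !) ⟩
  suc a * (p * (a ! * (suc b * b !))) + suc b * (r * (suc a * a ! * b !))
    ≡⟨ cong₂ (λ x y → suc a * x + suc b * y) (paths-! a (suc b)) (paths-! (suc a) b) ⟩
  suc a * (a + suc b) ! + suc b * suc (a + b) !
    ≡⟨ cong (λ x → suc a * x ! + suc b * suc (a + b) !) (+-suc a b) ⟩
  suc a * suc (a + b) ! + suc b * suc (a + b) !
    ≡⟨ *-distribʳ-+ (suc (a + b) !) (suc a) (suc b) ⟨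
  (suc a + suc b) * suc (a + b) !
    ≡⟨ cong (λ x → (suc a + suc b) * x !) (+-suc a b) ⟨
  (suc a + suc b) ! ∎
  where
  open ≡-Reasoning
  p r : ℕ
  p = paths a (suc b)
  r = paths (suc a) b
  split : ∀ p r A B x y → (p + r) * (A * x * (B * y)) ≡ A * (p * (x * (B * y))) + B * (r * (A * x * y))
  split = solve-∀

-- Lower bounds for binomial coefficients.

paths-monoʳ : ∀ a b j → paths a b ≤ paths a (j + b)
paths-monoʳ a b zero    = ≤-refl
paths-monoʳ a b (suc j) = ≤-trans (paths-monoʳ a b j) (step a (j + b))
  where
  step : ∀ a b → paths a b ≤ paths a (suc b)
  step zero    b = ≤-refl
  step (suc a) b = m≤n+m _ _

paths-monoˡ : ∀ a b i → paths a b ≤ paths (i + a) b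
paths-monoˡ a b zero    = ≤-refl
paths-monoˡ a b (suc i) = ≤-trans (paths-monoˡ a b i) (step (i + a) b)
  where
  step : ∀ a b → paths a b ≤ paths (suc a) b
  step zero    zero    = ≤-refl
  step (suc a) zero    = ≤-refl
  step a       (suc b) = m≤m+n _ _

-- Concatenation counts the lattice paths through one prescribed corner; this is a single term of
-- Vandermonde's identity.
paths-* : ∀ i j a b → paths i j * paths a b ≤ paths (i + a) (j + b)
paths-* zero    j       a b = ≤-trans (≤-reflexive (*-identityˡ _)) (paths-monoʳ a b j)
paths-* (suc i) zero    a b = ≤-trans (≤-reflexive (*-identityˡ _)) (paths-monoˡ a b (suc i))
paths-* (suc i) (suc j) a b = ≤-trans
  (≤-reflexive (*-distribʳ-+ (paths a b) (paths i (suc j)) (paths (suc i) j)))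
  (+-mono-≤ (paths-* i (suc j) a b) (paths-* (suc i) j a b))

220^-step : ∀ q i j {a b a′ b′} → i + a′ ≡ a → j + b′ ≡ b →
            220 ≤ paths i j → 220 ^ q ≤ paths a′ b′ → 220 ^ suc q ≤ paths a b
220^-step q i j {a′ = a′} {b′} refl refl p r = ≤-trans (*-mono-≤ p r) (paths-* i j a′ b′)

-- Cut the a + b steps into blocks of 12, at least 3 of each kind per block; 220 = (12 choose 3).
220^q≤paths : ∀ q a b → 3 * q ≤ a → 3 * q ≤ b → 12 * q ≤ a + b → 220 ^ q ≤ paths a b
220^q≤paths zero    a b _  _  _   = positive a b
  where
  positive : ∀ a b → 1 ≤ paths a b
  positive zero    b       = ≤-refl
  positive (suc a) zero    = ≤-refl
  positive (suc a) (suc b) = ≤-trans (positive a (suc b)) (m≤m+n _ _)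
220^q≤paths (suc q) a b 3≤a 3≤b 12≤ with (9 + 3 * q) ≤? a
-- A block of 9 steps of the first kind and 3 of the second leaves at least `3 * q` of each kind.
... | yes 9≤a = 220^-step q 9 3 {a′ = a ∸ 9} {b ∸ 3} 9+a′≡a 3+b′≡b (m≤m+n 220 0)
  (220^q≤paths q (a ∸ 9) (b ∸ 3) a′≥ b′≥ sum≥)
  where
  3≤b′ : 3 + 3 * q ≤ b
  3≤b′ = ≤-trans (≤-reflexive (sym (*-suc 3 q))) 3≤b
  9+a′≡a : 9 + (a ∸ 9) ≡ a
  9+a′≡a = m+[n∸m]≡n (≤-trans (m≤m+n 9 _) 9≤a)
  3+b′≡b : 3 + (b ∸ 3) ≡ b
  3+b′≡b = m+[n∸m]≡n (≤-trans (m≤m+n 3 _) 3≤b′)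
  a′≥ : 3 * q ≤ a ∸ 9
  a′≥ = m+n≤o⇒m≤o∸n (3 * q) (≤-trans (≤-reflexive (+-comm (3 * q) 9)) 9≤a)
  b′≥ : 3 * q ≤ b ∸ 3
  b′≥ = m+n≤o⇒m≤o∸n (3 * q) (≤-trans (≤-reflexive (+-comm (3 * q) 3)) 3≤b′)
  regroup : ∀ x y → 9 + x + (3 + y) ≡ 12 + (x + y)
  regroup = solve-∀
  sum≥ : 12 * q ≤ (a ∸ 9) + (b ∸ 3)
  sum≥ = +-cancelˡ-≤ 12 _ _ (begin
    12 + 12 * q                ≡⟨ *-suc 12 q ⟨
    12 * suc q                 ≤⟨ 12≤ ⟩
    a + b                      ≡⟨ cong₂ _+_ 9+a′≡a 3+b′≡b ⟨
    9 + (a ∸ 9) + (3 + (b ∸ 3)) ≡⟨ regroup (a ∸ 9) (b ∸ 3) ⟩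
    12 + ((a ∸ 9) + (b ∸ 3))   ∎)
    where open ≤-Reasoning
-- Now `a` is `i + 3 * q` with i from 3 to 8. The block takes i and 12 - i steps, leaving exactly
-- `3 * q` of the first kind and at least `9 * q` of the second.
... | no  a<9 = few (a ∸ 3 * q) (m∸n+n≡m {a} {3 * q} (≤-trans (*-monoʳ-≤ 3 (n≤1+n q)) 3≤a))
  where
  block : ∀ i j → 220 ≤ paths i j → i + j ≡ 12 → i + 3 * q ≡ a → 220 ^ suc q ≤ paths a b
  block i j p i+j eq = 220^-step q i j {a′ = 3 * q} {b ∸ j} eq j+b′≡b p
    (220^q≤paths q (3 * q) (b ∸ j) ≤-refl (≤-trans (*-monoˡ-≤ q (m≤m+n 3 6)) b′≥) sum≥)
    where
    regroup : ∀ i j q → i + 3 * q + (j + 9 * q) ≡ i + j + 12 * q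
    regroup = solve-∀
    j+9q≤b : j + 9 * q ≤ b
    j+9q≤b = +-cancelˡ-≤ (i + 3 * q) _ _ (begin
      i + 3 * q + (j + 9 * q) ≡⟨ regroup i j q ⟩
      i + j + 12 * q          ≡⟨ cong (_+ 12 * q) i+j ⟩
      12 + 12 * q             ≡⟨ *-suc 12 q ⟨
      12 * suc q              ≤⟨ 12≤ ⟩
      a + b                   ≡⟨ cong (_+ b) eq ⟨
      i + 3 * q + b           ∎)
      where open ≤-Reasoning
    j+b′≡b : j + (b ∸ j) ≡ b
    j+b′≡b = m+[n∸m]≡n (≤-trans (m≤m+n j _) j+9q≤b)
    b′≥ : 9 * q ≤ b ∸ j
    b′≥ = m+n≤o⇒m≤o∸n (9 * q) (≤-trans (≤-reflexive (+-comm (9 * q) j)) j+9q≤b)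
    sum≥ : 12 * q ≤ 3 * q + (b ∸ j)
    sum≥ = ≤-trans (≤-reflexive (*-distribʳ-+ q 3 9)) (+-monoʳ-≤ (3 * q) b′≥)
  small : ∀ i → i + 3 * q ≡ a → 3 ≤ i
  small i eq = +-cancelʳ-≤ (3 * q) 3 i (≤-trans (≤-reflexive (sym (*-suc 3 q))) (≤-trans 3≤a (≤-reflexive (sym eq))))
  few : ∀ i → i + 3 * q ≡ a → 220 ^ suc q ≤ paths a b
  few 0 eq = contradiction (small 0 eq) λ()
  few 1 eq = contradiction (small 1 eq) λ{ (s≤s ()) }
  few 2 eq = contradiction (small 2 eq) λ{ (s≤s (s≤s ())) }
  few 3 eq = block 3 9 (m≤m+n 220 0) refl eq
  few 4 eq = block 4 8 (m≤m+n 220 275) refl eq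
  few 5 eq = block 5 7 (m≤m+n 220 572) refl eq
  few 6 eq = block 6 6 (m≤m+n 220 704) refl eq
  few 7 eq = block 7 5 (m≤m+n 220 572) refl eq
  few 8 eq = block 8 4 (m≤m+n 220 275) refl eq
  few (suc (suc (suc (suc (suc (suc (suc (suc (suc i))))))))) eq =
    contradiction (≤-trans (+-monoˡ-≤ (3 * q) (m≤m+n 9 i)) (≤-reflexive eq)) a<9

orders-bound : ∀ {n} q (S : Vec Bool n) → 12 * q ≤ n → 3 * q ≤ count true S → 3 * q ≤ count false S →
               orders S * 220 ^ q ≤ n !
orders-bound {n} q S 12q≤n t f = begin
  orders S * 220 ^ q                          ≤⟨ *-monoʳ-≤ (orders S) (220^q≤paths q _ _ t f
                                                   (≤-trans 12q≤n (≤-reflexive (sym (count-total S))))) ⟩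
  orders S * paths (count true S) (count false S) ≡⟨ *-comm (orders S) _ ⟩
  paths (count true S) (count false S) * orders S ≡⟨ paths-! (count true S) (count false S) ⟩
  (count true S + count false S) !            ≡⟨ cong _! (count-total S) ⟩
  n !                                         ∎
  where open ≤-Reasoning

-- The entropy estimate and the first moment bound.

36[1+q]<2^q : ∀ p → 36 * suc (9 + p) < 2 ^ (9 + p)
-- 360 < 512 holds at q = 9, whereas q = 8 would ask for 324 < 256. This is the origin of 108 = 12 ·
-- 9 as the lower bound on M.
36[1+q]<2^q zero    = ≤ᵇ⇒≤ _ _ tt
36[1+q]<2^q (suc p) = begin-strict
  36 * suc (10 + p)          ≤⟨ m≤m+n _ (36 * (9 + p)) ⟩
  36 * suc (10 + p) + 36 * (9 + p) ≡⟨ double p ⟩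
  2 * (36 * suc (9 + p))     <⟨ *-monoʳ-< 2 (36[1+q]<2^q p) ⟩
  2 * 2 ^ (9 + p)            ∎
  where
  open ≤-Reasoning
  double : ∀ p → 36 * suc (10 + p) + 36 * (9 + p) ≡ 2 * (36 * suc (9 + p))
  double = solve-∀

^-distribʳ-* : ∀ k m n → (m * n) ^ k ≡ m ^ k * n ^ k
^-distribʳ-* zero    m n = refl
^-distribʳ-* (suc k) m n = trans (cong (m * n *_) (^-distribʳ-* k m n)) (interchange m n (m ^ k) (n ^ k))
  where
  interchange : ∀ a b c d → a * b * (c * d) ≡ a * c * (b * d)
  interchange = solve-∀

-- The entropy comparison: 32 (33/32)³⁶ < 97 is less than half of 220.
entropy-gap : ∀ p r → r < 12 → let q = 9 + p ; n = r + q * 12 in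
  33 ^ n * 33 ^ n * 33 ^ n * suc n < 32 ^ (3 * r + 35 * q) * 220 ^ q
entropy-gap p r r<12 = begin-strict
  33 ^ n * 33 ^ n * 33 ^ n * suc n
    ≡⟨ cong (_* suc n) powers ⟩
  33 ^ (3 * r) * (33 ^ 36) ^ q * suc n
    ≤⟨ *-mono-≤ (*-mono-≤ (remainder r<12) (^-monoˡ-≤ q (≤ᵇ⇒≤ (33 ^ 36) (32 ^ 35 * 97) tt))) size ⟩
  3 * 32 ^ (3 * r) * (32 ^ 35 * 97) ^ q * (12 * suc q)
    ≡⟨ cong (λ x → 3 * 32 ^ (3 * r) * x * (12 * suc q)) (trans (^-distribʳ-* q (32 ^ 35) 97) (cong (_* 97 ^ q) (^-*-assoc 32 35 q))) ⟩
  3 * 32 ^ (3 * r) * (32 ^ (35 * q) * 97 ^ q) * (12 * suc q)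
    ≡⟨ regroup (32 ^ (3 * r)) (32 ^ (35 * q)) (97 ^ q) (suc q) ⟩
  32 ^ (3 * r) * 32 ^ (35 * q) * (36 * suc q * 97 ^ q)
    -- The polynomial factor 36 (q + 1) is absorbed by doubling 97 to 194, which is still below 220.
    <⟨ *-monoʳ-< (32 ^ (3 * r) * 32 ^ (35 * q)) {{m*n≢0 _ _ {{m^n≢0 32 (3 * r)}} {{m^n≢0 32 (35 * q)}}}}
         (*-monoˡ-< (97 ^ q) {{m^n≢0 97 q}} (36[1+q]<2^q p)) ⟩
  32 ^ (3 * r) * 32 ^ (35 * q) * (2 ^ q * 97 ^ q)
    ≡⟨ cong₂ _*_ (sym (^-distribˡ-+-* 32 (3 * r) (35 * q))) (sym (^-distribʳ-* q 2 97)) ⟩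
  32 ^ (3 * r + 35 * q) * 194 ^ q
    ≤⟨ *-monoʳ-≤ (32 ^ (3 * r + 35 * q)) (^-monoˡ-≤ q (m≤m+n 194 26)) ⟩
  32 ^ (3 * r + 35 * q) * 220 ^ q ∎
  where
  open ≤-Reasoning
  q n : ℕ
  q = 9 + p
  n = r + q * 12
  triple : ∀ r q → r + q * 12 + (r + q * 12) + (r + q * 12) ≡ 3 * r + 36 * q
  triple = solve-∀
  powers : 33 ^ n * 33 ^ n * 33 ^ n ≡ 33 ^ (3 * r) * (33 ^ 36) ^ q
  powers = begin-equality
    33 ^ n * 33 ^ n * 33 ^ n      ≡⟨ cong (_* 33 ^ n) (^-distribˡ-+-* 33 n n) ⟨
    33 ^ (n + n) * 33 ^ n         ≡⟨ ^-distribˡ-+-* 33 (n + n) n ⟨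
    33 ^ (n + n + n)              ≡⟨ cong (33 ^_) (triple r q) ⟩
    33 ^ (3 * r + 36 * q)         ≡⟨ ^-distribˡ-+-* 33 (3 * r) (36 * q) ⟩
    33 ^ (3 * r) * 33 ^ (36 * q)  ≡⟨ cong (33 ^ (3 * r) *_) (^-*-assoc 33 36 q) ⟨
    33 ^ (3 * r) * (33 ^ 36) ^ q  ∎
  -- The remainder r adds at most 33 factors 33/32, and (33/32)^33 < 3. This 3 and the 12 from
  -- `size` make up the 36.
  remainder : ∀ {r} → r < 12 → 33 ^ (3 * r) ≤ 3 * 32 ^ (3 * r)
  remainder = toWitness {a? = allUpTo? (λ r → 33 ^ (3 * r) ≤? 3 * 32 ^ (3 * r)) 12} tt
  size : suc n ≤ 12 * suc q
  size = ≤-trans (+-monoˡ-≤ (q * 12) r<12) (≤-reflexive (*-comm (suc q) 12))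
  regroup : ∀ a b c d → 3 * a * (b * c) * (12 * d) ≡ a * b * (36 * d * c)
  regroup = solve-∀

-- An exponential weight instead of a count of edge sets, as in a Chernoff bound: it multiplies over
-- coordinates, so its sums are powers of 33. For one disagreement in 36 the cost (1 + x)^36 / x^35
-- is least at x = 35, and 32 is close to that.
weight : ∀ {n} → Vec Bool n → Vec Bool n → ℕ
weight S R = 32 ^ agree S R

weight-comm : ∀ {n} (S R : Vec Bool n) → weight S R ≡ weight R S
weight-comm S R = cong (32 ^_) (agree-comm S R)
  where
  agree-comm : ∀ {n} (S R : Vec Bool n) → agree S R ≡ agree R S
  agree-comm []      []      = refl
  agree-comm (a ∷ S) (b ∷ R) = cong₂ (λ x y → (if x then 0 else 1) + y) (xor-comm a b) (agree-comm S R)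

∑-weight : ∀ {n} (R : Vec Bool n) → ∑ (subsets n) (λ S → weight S R) ≡ 33 ^ n
∑-weight []              = refl
∑-weight {suc n} (b ∷ R) = begin
  ∑ (subsets (suc n)) (λ S → weight S (b ∷ R))
    ≡⟨ ∑-subsets-suc n (λ S → weight S (b ∷ R)) ⟩
  ∑ (subsets n) (λ S → weight (true ∷ S) (b ∷ R)) + ∑ (subsets n) (λ S → weight (false ∷ S) (b ∷ R))
    ≡⟨ cong₂ _+_ (part true) (part false) ⟩
  32 ^ [ true ≐ b ] * 33 ^ n + 32 ^ [ false ≐ b ] * 33 ^ n
    ≡⟨ total b (33 ^ n) ⟩
  33 ^ suc n ∎
  where
  open ≡-Reasoning
  part : ∀ a → ∑ (subsets n) (λ S → weight (a ∷ S) (b ∷ R)) ≡ 32 ^ [ a ≐ b ] * 33 ^ n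
  part a = begin
    ∑ (subsets n) (λ S → weight (a ∷ S) (b ∷ R))
      ≡⟨ ∑-cong (subsets n) (λ S → ^-distribˡ-+-* 32 [ a ≐ b ] (agree S R)) ⟩
    ∑ (subsets n) (λ S → 32 ^ [ a ≐ b ] * weight S R)
      ≡⟨ ∑-*ˡ (subsets n) (32 ^ [ a ≐ b ]) (λ S → weight S R) ⟩
    32 ^ [ a ≐ b ] * ∑ (subsets n) (λ S → weight S R)
      ≡⟨ cong (32 ^ [ a ≐ b ] *_) (∑-weight R) ⟩
    32 ^ [ a ≐ b ] * 33 ^ n ∎
  total : ∀ b x → 32 ^ [ true ≐ b ] * x + 32 ^ [ false ≐ b ] * x ≡ 33 * x
  total true  = λ x → trans (sym (*-distribʳ-+ x 32 1)) refl
  total false = λ x → trans (sym (*-distribʳ-+ x 1 32)) refl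

-- Averages out one random permutation while everything independent of it sits in `x`; it is applied
-- once for each of the two permutations.
∑-weight-image : ∀ {n} (x : Vec Bool n → Vec Bool n → ℕ) →
  ∑ (codes n) (λ c → ∑ (subsets n) (λ S → ∑ (subsets n) (λ R → x S R * weight (image c S) R))) ≤
  ∑ (subsets n) (λ S → ∑ (subsets n) (λ R → x S R * (orders S * 33 ^ n)))
∑-weight-image {n} x = begin
  ∑ (codes n) (λ c → ∑ (subsets n) (λ S → ∑ (subsets n) (λ R → x S R * weight (image c S) R)))
    ≡⟨ ∑-swap (codes n) (subsets n) _ ⟩
  ∑ (subsets n) (λ S → ∑ (codes n) (λ c → ∑ (subsets n) (λ R → x S R * weight (image c S) R)))
    ≡⟨ ∑-cong (subsets n) (λ S → ∑-swap (codes n) (subsets n) _) ⟩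
  ∑ (subsets n) (λ S → ∑ (subsets n) (λ R → ∑ (codes n) (λ c → x S R * weight (image c S) R)))
    ≤⟨ ∑-mono (subsets n) (λ S → ∑-mono (subsets n) (λ R → average S R)) ⟩
  ∑ (subsets n) (λ S → ∑ (subsets n) (λ R → x S R * (orders S * 33 ^ n))) ∎
  where
  open ≤-Reasoning
  average : ∀ S R → ∑ (codes n) (λ c → x S R * weight (image c S) R) ≤ x S R * (orders S * 33 ^ n)
  average S R = begin
    ∑ (codes n) (λ c → x S R * weight (image c S) R)  ≡⟨ ∑-*ˡ (codes n) (x S R) _ ⟩
    x S R * ∑ (codes n) (λ c → weight (image c S) R)  ≤⟨ *-monoʳ-≤ (x S R) (∑-image-≤ S (λ T → weight T R)) ⟩
    x S R * (orders S * ∑ (subsets n) (λ T → weight T R)) ≡⟨ cong (λ y → x S R * (orders S * y)) (∑-weight R) ⟩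
    x S R * (orders S * 33 ^ n)                       ∎

module _ (q n : ℕ) (12q≤n : 12 * q ≤ n) where

  balanced? : (S : Vec Bool n) → Dec (3 * q ≤ count true S × 3 * q ≤ count false S)
  balanced? S = (3 * q ≤? count true S) ×-dec (3 * q ≤? count false S)

  [balanced] : Vec Bool n → ℕ
  [balanced] S = if does (balanced? S) then 1 else 0

  -- The total weight of all node sets with balanced left half `S` and right half `R`. The three
  -- weights belong to the three matchings, the first being the identity.
  penalty : Code n × Code n → ℕ
  penalty (c , d) = ∑ (subsets n) λ S → ∑ (subsets n) λ R →
    [balanced] S * weight S R * weight (image c S) R * weight (image d S) R

  [balanced]-orders : ∀ S → [balanced] S * orders S * 220 ^ q ≤ n !
  [balanced]-orders S = by-cases (balanced? S)
    where
    by-cases : (d : Dec (3 * q ≤ count true S × 3 * q ≤ count false S)) →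
               (if does d then 1 else 0) * orders S * 220 ^ q ≤ n !
    by-cases (yes (t , f)) = ≤-trans (≤-reflexive (cong (_* 220 ^ q) (*-identityˡ (orders S)))) (orders-bound q S 12q≤n t f)
    by-cases (no _)        = z≤n

  -- Averaging over both permutations yields `orders S` twice. In `bound` one copy is traded
  -- together with `220 ^ q` for n!; the other survives and is summed over all `S` by `∑-orders`.
  ∑-penalty : ∑ (cartesianProduct (codes n) (codes n)) penalty * 220 ^ q ≤
              n ! * n ! * (33 ^ n * 33 ^ n * 33 ^ n * suc n)
  ∑-penalty = begin
    ∑ (cartesianProduct (codes n) (codes n)) penalty * 220 ^ q
      ≡⟨ cong (_* 220 ^ q) (∑-× (codes n) (codes n) penalty) ⟩
    ∑ (codes n) (λ c → ∑ (codes n) (λ d → penalty (c , d))) * 220 ^ q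
      ≤⟨ *-monoˡ-≤ (220 ^ q) (∑-mono (codes n) (λ c →
           ∑-weight-image (λ S R → [balanced] S * weight S R * weight (image c S) R))) ⟩
    ∑ (codes n) (λ c → ∑ (subsets n) (λ S → ∑ (subsets n) (λ R →
      [balanced] S * weight S R * weight (image c S) R * (orders S * Q)))) * 220 ^ q
      ≡⟨ cong (_* 220 ^ q) (∑-cong (codes n) (λ c → ∑-cong (subsets n) (λ S → ∑-cong (subsets n) (λ R →
           shift ([balanced] S * weight S R) (weight (image c S) R) (orders S * Q))))) ⟩
    ∑ (codes n) (λ c → ∑ (subsets n) (λ S → ∑ (subsets n) (λ R →
      [balanced] S * weight S R * (orders S * Q) * weight (image c S) R))) * 220 ^ q
      ≤⟨ *-monoˡ-≤ (220 ^ q) (∑-weight-image (λ S R → [balanced] S * weight S R * (orders S * Q))) ⟩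
    ∑ (subsets n) (λ S → ∑ (subsets n) (λ R →
      [balanced] S * weight S R * (orders S * Q) * (orders S * Q))) * 220 ^ q
      ≡⟨ ∑-*ʳ (subsets n) _ (220 ^ q) ⟨
    ∑ (subsets n) (λ S → ∑ (subsets n) (λ R →
      [balanced] S * weight S R * (orders S * Q) * (orders S * Q)) * 220 ^ q)
      ≤⟨ ∑-mono (subsets n) bound ⟩
    ∑ (subsets n) (λ S → n ! * (Q * Q * Q) * orders S)
      ≡⟨ ∑-*ˡ (subsets n) (n ! * (Q * Q * Q)) orders ⟩
    n ! * (Q * Q * Q) * ∑ (subsets n) orders
      ≡⟨ cong (n ! * (Q * Q * Q) *_) (∑-orders n) ⟩
    n ! * (Q * Q * Q) * (suc n * n !)
      ≡⟨ regroup (n !) (Q * Q * Q) (suc n) ⟩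
    n ! * n ! * (Q * Q * Q * suc n) ∎
    where
    open ≤-Reasoning
    Q : ℕ
    Q = 33 ^ n
    shift : ∀ a b c → a * b * c ≡ a * c * b
    shift = solve-∀
    regroup : ∀ a b c → a * b * (c * a) ≡ a * a * (b * c)
    regroup = solve-∀
    collect : ∀ r w o Q → r * w * (o * Q) * (o * Q) ≡ r * o * o * (Q * Q) * w
    collect = solve-∀
    collect′ : ∀ r o Q z → r * o * o * (Q * Q) * Q * z ≡ r * o * z * (Q * Q * Q) * o
    collect′ = solve-∀
    bound : ∀ S → ∑ (subsets n) (λ R → [balanced] S * weight S R * (orders S * Q) * (orders S * Q)) * 220 ^ q
                ≤ n ! * (Q * Q * Q) * orders S
    bound S = begin
      ∑ (subsets n) (λ R → r * weight S R * (o * Q) * (o * Q)) * 220 ^ q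
        ≡⟨ cong (_* 220 ^ q) (∑-cong (subsets n) (λ R → trans (collect r (weight S R) o Q)
             (cong (r * o * o * (Q * Q) *_) (weight-comm S R)))) ⟩
      ∑ (subsets n) (λ R → r * o * o * (Q * Q) * weight R S) * 220 ^ q
        ≡⟨ cong (_* 220 ^ q) (trans (∑-*ˡ (subsets n) (r * o * o * (Q * Q)) (λ R → weight R S))
             (cong (r * o * o * (Q * Q) *_) (∑-weight S))) ⟩
      r * o * o * (Q * Q) * Q * 220 ^ q
        ≡⟨ collect′ r o Q (220 ^ q) ⟩
      r * o * 220 ^ q * (Q * Q * Q) * o
        ≤⟨ *-monoˡ-≤ o (*-monoˡ-≤ (Q * Q * Q) ([balanced]-orders S)) ⟩
      n ! * (Q * Q * Q) * o ∎
      where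
      r o : ℕ
      r = [balanced] S
      o = orders S

-- The three distances count the cut edges of the node set with left half `S` and right half `R` in
-- the matchings identity, `perm c` and `perm d`.
Expanding : ℕ → ∀ {n} → Code n → Code n → Set
Expanding q {n} c d = ∀ (S R : Vec Bool n) → 3 * q ≤ count true S → 3 * q ≤ count false S →
  q < ham S R + ham S (preimage c R) + ham S (preimage d R)

abstract
  expanding-codes : ∀ p r → r < 12 → let q = 9 + p ; n = r + q * 12 in
    ∃ λ (c : Code n) → ∃ λ (d : Code n) → Expanding q c d
  expanding-codes p r r<12 = c , d , expanding
    where
    q n bound : ℕ
    q = 9 + p
    n = r + q * 12
    bound = 32 ^ (3 * r + 35 * q)
    12q≤n : 12 * q ≤ n
    12q≤n = ≤-trans (≤-reflexive (*-comm 12 q)) (m≤n+m (q * 12) r)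
    pen : Code n × Code n → ℕ
    pen = penalty q n 12q≤n
    pairs : List (Code n × Code n)
    pairs = cartesianProduct (codes n) (codes n)

    average<bound : ∑ pairs pen < length pairs * bound
    average<bound = *-cancelʳ-< (220 ^ q) _ _ (begin-strict
      ∑ pairs pen * 220 ^ q ≤⟨ ∑-penalty q n 12q≤n ⟩
      n ! * n ! * (33 ^ n * 33 ^ n * 33 ^ n * suc n)
        <⟨ *-monoʳ-< (n ! * n !) {{m*n≢0 _ _ {{n !≢0}} {{n !≢0}}}} (entropy-gap p r r<12) ⟩
      n ! * n ! * (bound * 220 ^ q) ≡⟨ *-assoc (n ! * n !) bound (220 ^ q) ⟨
      n ! * n ! * bound * 220 ^ q ≡⟨ cong (λ x → x * bound * 220 ^ q) length-pairs ⟨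
      length pairs * bound * 220 ^ q ∎)
      where
      open ≤-Reasoning
      length-pairs : length pairs ≡ n ! * n !
      length-pairs = trans (length-cartesianProduct (codes n) (codes n)) (cong₂ _*_ (length-codes n) (length-codes n))

    good : ∃ λ cd → pen cd < bound
    good = ∑-average pairs pen bound average<bound
    c d : Code n
    c = proj₁ (proj₁ good)
    d = proj₂ (proj₁ good)

    -- A violating pair `S`, `R` disagrees on at most q of the 3n edges, so its own term in the
    -- penalty already reaches 32^(3n - q), which is `bound`.
    expanding : Expanding q c d
    expanding S R t f = ≰⇒> λ few → <⇒≱ (proj₂ good) (begin
      bound
        ≤⟨ ^-monoʳ-≤ 32 (agreements few) ⟩
      32 ^ (agree S R + agree (image c S) R + agree (image d S) R)
        ≡⟨ trans (^-distribˡ-+-* 32 (agree S R + agree (image c S) R) (agree (image d S) R))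
             (cong (_* weight (image d S) R) (^-distribˡ-+-* 32 (agree S R) (agree (image c S) R))) ⟩
      weight S R * weight (image c S) R * weight (image d S) R
        ≡⟨ cong (λ x → x * weight (image c S) R * weight (image d S) R) (*-identityˡ (weight S R)) ⟨
      1 * weight S R * weight (image c S) R * weight (image d S) R
        ≡⟨ cong (λ x → (if x then 1 else 0) * weight S R * weight (image c S) R * weight (image d S) R)
             (dec-true (balanced? q n 12q≤n S) (t , f)) ⟨
      [balanced] q n 12q≤n S * weight S R * weight (image c S) R * weight (image d S) R
        ≤⟨ ∑-∈ (λ R → [balanced] q n 12q≤n S * weight S R * weight (image c S) R * weight (image d S) R) (∈-subsets R) ⟩
      ∑ (subsets n) (λ R → [balanced] q n 12q≤n S * weight S R * weight (image c S) R * weight (image d S) R)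
        ≤⟨ ∑-∈ (λ S → ∑ (subsets n) (λ R → [balanced] q n 12q≤n S * weight S R * weight (image c S) R * weight (image d S) R)) (∈-subsets S) ⟩
      pen (proj₁ good) ∎)
      where
      open ≤-Reasoning
      triple : ∀ r q → 3 * r + 35 * q + q ≡ r + q * 12 + (r + q * 12) + (r + q * 12)
      triple = solve-∀
      agreements : ham S R + ham S (preimage c R) + ham S (preimage d R) ≤ q →
        3 * r + 35 * q ≤ agree S R + agree (image c S) R + agree (image d S) R
      agreements few = +-cancelʳ-≤ q _ _ (begin
        3 * r + 35 * q + q
          ≡⟨ triple r q ⟩
        n + n + n
          ≡⟨ cong₂ _+_ (cong₂ _+_ (agree+ham S R) (agree+ham (image c S) R)) (agree+ham (image d S) R) ⟨
        agree S R + ham S R + (agree (image c S) R + ham (image c S) R) + (agree (image d S) R + ham (image d S) R)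
          ≡⟨ +-interchange₃ (agree S R) (agree (image c S) R) (agree (image d S) R) (ham S R) (ham (image c S) R) (ham (image d S) R) ⟩
        agreed + (ham S R + ham (image c S) R + ham (image d S) R)
          ≡⟨ cong₂ (λ x y → agreed + (ham S R + x + y)) (ham-image c S R) (ham-image d S R) ⟩
        agreed + (ham S R + ham S (preimage c R) + ham S (preimage d R))
          ≤⟨ +-monoʳ-≤ agreed few ⟩
        agreed + q ∎)
        where
        agreed : ℕ
        agreed = agree S R + agree (image c S) R + agree (image d S) R

-- Sizes of node sets in a bipartite graph.

open Sum +-0-commutativeMonoid using (sum; sum-cong-≗; sum-permute; sum-replicate-zero) renaming (∑-distrib-+ to sum-distrib-+)

xor-interchange : ∀ a b c d → (a xor b) xor (c xor d) ≡ (a xor c) xor (b xor d)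
xor-interchange false false c d = refl
xor-interchange false true  c d = Bool.not-distribʳ-xor c d
xor-interchange true  false c d = Bool.not-distribˡ-xor c d
xor-interchange true  true  c d = sym (trans (sym (Bool.not-distribˡ-xor c (not d)))
  (trans (cong not (sym (Bool.not-distribʳ-xor c d))) (Bool.not-involutive (c xor d))))

sum-mono : ∀ {n} {f g : Fin n → ℕ} → (∀ i → f i ≤ g i) → sum f ≤ sum g
sum-mono {zero}  f≤g = z≤n
sum-mono {suc n} f≤g = +-mono-≤ (f≤g zero) (sum-mono (f≤g ∘ suc))

sum-replace : ∀ {n} (f g : Fin n → ℕ) k → (∀ i → i ≢ k → g i ≤ f i) → sum g ≤ sum f + g k
sum-replace f g zero    g≤f = ≤-trans (+-monoʳ-≤ (g zero) (sum-mono (λ i → g≤f (suc i) λ())))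
  (≤-trans (≤-reflexive (+-comm (g zero) _)) (+-monoˡ-≤ (g zero) (m≤n+m _ (f zero))))
sum-replace f g (suc k) g≤f = ≤-trans
  (+-mono-≤ (g≤f zero λ()) (sum-replace (f ∘ suc) (g ∘ suc) k (λ i i≢k → g≤f (suc i) (i≢k ∘ Fin.suc-injective))))
  (≤-reflexive (sym (+-assoc (f zero) _ _)))

sum-ones : ∀ n → sum {n} (λ _ → 1) ≡ n
sum-ones zero    = refl
sum-ones (suc n) = cong suc (sum-ones n)

# : ∀ {n} → (Fin n → Bool) → ℕ
# f = sum (λ i → if f i then 1 else 0)

#-not : ∀ {n} (f : Fin n → Bool) → # f + # (not ∘ f) ≡ n
#-not {n} f = trans (sym (sum-distrib-+ (λ i → if f i then 1 else 0) (λ i → if not (f i) then 1 else 0)))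
  (trans (sum-cong-≗ (λ i → one (f i))) (sum-ones n))
  where
  one : ∀ b → (if b then 1 else 0) + (if not b then 1 else 0) ≡ 1
  one true  = refl
  one false = refl

Node : ℕ → Set
Node M = Fin M × Bool

pattern left i  = i , true
pattern right j = j , false

_≟ₙ_ : ∀ {M} → DecidableEquality (Node M)
_≟ₙ_ = ≡-dec Fin._≟_ Bool._≟_

lefts rights : ∀ {M} → (Node M → Bool) → Fin M → Bool
lefts  χ i = χ (left i)
rights χ i = χ (right i)

size : ∀ {M} → (Node M → Bool) → ℕ
size χ = # (lefts χ) + # (rights χ)

size-mono : ∀ {M} {χ χ′ : Node M → Bool} → (∀ u → (if χ u then 1 else 0) ≤ (if χ′ u then 1 else 0)) → size χ ≤ size χ′
size-mono χ≤ = +-mono-≤ (sum-mono (λ i → χ≤ (left i))) (sum-mono (λ i → χ≤ (right i)))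

size-not : ∀ {M} (χ : Node M → Bool) → size χ + size (not ∘ χ) ≡ M + M
size-not χ = trans (+-interchange (# (lefts χ)) (# (rights χ)) (# (lefts (not ∘ χ))) (# (rights (not ∘ χ))))
  (cong₂ _+_ (#-not (lefts χ)) (#-not (rights χ)))

size-∨ : ∀ {M} (χ χ′ : Node M → Bool) → size (λ u → χ u ∨ χ′ u) ≤ size χ + size χ′
size-∨ χ χ′ = ≤-trans (+-mono-≤ (#-∨ (lefts χ) (lefts χ′)) (#-∨ (rights χ) (rights χ′)))
  (≤-reflexive (+-interchange (# (lefts χ)) (# (lefts χ′)) (# (rights χ)) (# (rights χ′))))
  where
  bits : ∀ a b → (if a ∨ b then 1 else 0) ≤ (if a then 1 else 0) + (if b then 1 else 0)
  bits true  b = s≤s z≤n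
  bits false b = ≤-refl
  #-∨ : ∀ {n} (f g : Fin n → Bool) → # (λ i → f i ∨ g i) ≤ # f + # g
  #-∨ f g = ≤-trans (sum-mono (λ i → bits (f i) (g i)))
    (≤-reflexive (sum-distrib-+ (λ i → if f i then 1 else 0) (λ i → if g i then 1 else 0)))

if≤1 : ∀ b → (if b then 1 else 0) ≤ 1
if≤1 true  = ≤-refl
if≤1 false = z≤n

size-replace : ∀ {M} (χ χ′ : Node M → Bool) x → (∀ u → u ≢ x → χ′ u ≡ χ u) → size χ′ ≤ suc (size χ)
size-replace χ χ′ (left k) agree = ≤-trans
  (+-mono-≤ (≤-trans (sum-replace (λ i → if χ (left i) then 1 else 0) (λ i → if χ′ (left i) then 1 else 0) k
      (λ i i≢k → ≤-reflexive (cong (if_then 1 else 0) (agree (left i) (i≢k ∘ cong proj₁)))))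
      (+-monoʳ-≤ (# (lefts χ)) (if≤1 (χ′ (left k)))))
    (sum-mono (λ i → ≤-reflexive (cong (if_then 1 else 0) (agree (right i) λ())))))
  (≤-reflexive (shift (# (lefts χ)) (# (rights χ))))
  where
  shift : ∀ a b → a + 1 + b ≡ suc (a + b)
  shift = solve-∀
size-replace χ χ′ (right k) agree = ≤-trans
  (+-mono-≤ (sum-mono (λ i → ≤-reflexive (cong (if_then 1 else 0) (agree (left i) λ()))))
    (≤-trans (sum-replace (λ i → if χ (right i) then 1 else 0) (λ i → if χ′ (right i) then 1 else 0) k
      (λ i i≢k → ≤-reflexive (cong (if_then 1 else 0) (agree (right i) (i≢k ∘ cong proj₁)))))
      (+-monoʳ-≤ (# (rights χ)) (if≤1 (χ′ (right k))))))
  (≤-reflexive (shift (# (lefts χ)) (# (rights χ))))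
  where
  shift : ∀ a b → a + (b + 1) ≡ suc (a + b)
  shift = solve-∀

nodes : ∀ M → List (Node M)
nodes M = map (λ i → left i) (allFin M) ++ map (λ i → right i) (allFin M)

∈-nodes : ∀ {M} (u : Node M) → u ∈ nodes M
∈-nodes (left i)  = ∈-++⁺ˡ (∈-map⁺ _ (∈-allFin i))
∈-nodes (right i) = ∈-++⁺ʳ _ (∈-map⁺ _ (∈-allFin i))

-- The bipartite cubic multigraph with an edge i of colour c from left i to right (π c i).
module BaseGraph {M : ℕ} (π : Fin 3 → Permutation′ M) where

  open import Data.List.Membership.DecPropositional (_≟ₙ_ {M}) using (_∈?_)

  -- Cuts of the base graph.

  edge : Fin 3 → Node M → Fin M
  edge c (left i)  = i
  edge c (right j) = π c ⟨$⟩ˡ j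

  -- Edges at nodes of `X` are ignored as long as these nodes have not been put on a side.
  untouched : List (Node M) → Fin 3 → Fin M → Bool
  untouched X c i = not (does (left i ∈? X) ∨ does (right (π c ⟨$⟩ʳ i) ∈? X))

  crossing : List (Node M) → (Node M → Bool) → Fin 3 → Fin M → ℕ
  crossing X χ c i = if untouched X c i then [ χ (left i) ≠ χ (right (π c ⟨$⟩ʳ i)) ] else 0

  crossings : List (Node M) → (Node M → Bool) → ℕ
  crossings X χ = sum (crossing X χ 0F) + sum (crossing X χ 1F) + sum (crossing X χ 2F)

  cut : (Node M → Bool) → ℕ
  cut = crossings []

  assign : (Node M → Bool) → Node M → Bool → Node M → Bool
  assign χ x b u = if does (u ≟ₙ x) then b else χ u

  assign-≢ : ∀ χ x b u → u ≢ x → assign χ x b u ≡ χ u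
  assign-≢ χ x b u u≢x = cong (if_then b else χ u) (dec-false (u ≟ₙ x) u≢x)

  assign-≡ : ∀ χ x b → assign χ x b x ≡ b
  assign-≡ χ x b = cong (if_then b else χ x) (dec-true (x ≟ₙ x) refl)

  ∈?-≢ : ∀ {u x} X → u ≢ x → does (u ∈? (x ∷ X)) ≡ does (u ∈? X)
  ∈?-≢ {u} {x} X u≢x = does-⇔ (mk⇔ (λ { (here u≡x) → contradiction u≡x u≢x ; (there u∈X) → u∈X }) there)
    (u ∈? (x ∷ X)) (u ∈? X)

  crossing-assign : ∀ x X χ b c i → i ≢ edge c x → crossing X (assign χ x b) c i ≤ crossing (x ∷ X) χ c i
  crossing-assign x X χ b c i i≢ = ≤-reflexive (cong₂ (if_then_else 0)
    (cong₂ (λ y z → not (y ∨ z)) (sym (∈?-≢ X ≢l)) (sym (∈?-≢ X ≢r)))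
    (cong₂ [_≠_] (assign-≢ χ x b _ ≢l) (assign-≢ χ x b _ ≢r)))
    where
    ≢l : left i ≢ x
    ≢l refl = i≢ refl
    ≢r : right (π c ⟨$⟩ʳ i) ≢ x
    ≢r refl = i≢ (sym (inverseˡ (π c)))

  opposite : Fin 3 → Node M → Node M
  opposite c (left i)  = right (π c ⟨$⟩ʳ i)
  opposite c (right j) = left (π c ⟨$⟩ˡ j)

  crossing-edge : ∀ x X χ b c → crossing X (assign χ x b) c (edge c x) ≤ [ b ≠ χ (opposite c x) ]
  crossing-edge x X χ b c = ≤-trans (if-≤ (untouched X c (edge c x)) _) (≤-reflexive (ends x))
    where
    if-≤ : ∀ t n → (if t then n else 0) ≤ n
    if-≤ true  n = ≤-refl
    if-≤ false n = z≤n
    ends : ∀ x → [ assign χ x b (left (edge c x)) ≠ assign χ x b (right (π c ⟨$⟩ʳ edge c x)) ] ≡ [ b ≠ χ (opposite c x) ]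
    ends (left i)  = cong₂ [_≠_] (assign-≡ χ (left i) b) (assign-≢ χ (left i) b _ λ())
    ends (right j) = trans (cong₂ [_≠_] (assign-≢ χ (right j) b _ λ())
      (trans (cong (λ k → assign χ (right j) b (right k)) (inverseʳ (π c))) (assign-≡ χ (right j) b)))
      (cong (if_then 1 else 0) (xor-comm (χ (left (π c ⟨$⟩ˡ j))) b))

  -- Each x has three edges, so one of its two possible sides creates at most one new crossing.
  majority : ∀ x X χ → ∃ λ b → crossings X (assign χ x b) ≤ suc (crossings (x ∷ X) χ)
  majority x X χ = b , ≤-trans (+-mono-≤ (+-mono-≤ (colour 0F) (colour 1F)) (colour 2F))
    (≤-trans (≤-reflexive (+-interchange₃ (old 0F) (old 1F) (old 2F) _ _ _)) (≤-trans (+-monoʳ-≤ (crossings (x ∷ X) χ) (proj₂ side))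
      (≤-reflexive (+-comm _ 1))))
    where
    vote : ∀ r s t → ∃ λ b → [ b ≠ r ] + [ b ≠ s ] + [ b ≠ t ] ≤ 1
    vote true  true  t     = true  , if≤1 (not t)
    vote false false t     = false , if≤1 t
    vote true  false true  = true  , ≤-refl
    vote true  false false = false , ≤-refl
    vote false true  true  = true  , ≤-refl
    vote false true  false = false , ≤-refl
    side = vote (χ (opposite 0F x)) (χ (opposite 1F x)) (χ (opposite 2F x))
    b : Bool
    b = proj₁ side
    old : Fin 3 → ℕ
    old c = sum (crossing (x ∷ X) χ c)
    colour : ∀ c → sum (crossing X (assign χ x b) c) ≤ old c + [ b ≠ χ (opposite c x) ]
    colour c = ≤-trans (sum-replace (crossing (x ∷ X) χ c) (crossing X (assign χ x b) c) (edge c x) (crossing-assign x X χ b c))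
      (+-monoʳ-≤ (old c) (crossing-edge x X χ b c))

  -- The nodes of `X` are settled one at a time; each costs one crossing by `majority` and shifts
  -- the size by at most one.
  reassign : ∀ X χ → ∃ λ χ′ → cut χ′ ≤ crossings X χ + length X ×
             size χ′ ≤ size χ + length X × size χ ≤ size χ′ + length X
  reassign []      χ = χ , m≤m+n _ 0 , m≤m+n _ 0 , m≤m+n _ 0
  reassign (x ∷ X) χ with b , fewer ← majority x X χ with χ′ , cut≤ , ≤size , size≤ ← reassign X (assign χ x b) =
    χ′ , grow cut≤ fewer ,
    grow ≤size (size-replace χ (assign χ x b) x (assign-≢ χ x b)) ,
    ≤-trans (size-replace (assign χ x b) χ x (λ u u≢x → sym (assign-≢ χ x b u u≢x)))
      (≤-trans (s≤s size≤) (≤-reflexive (sym (+-suc _ _))))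
    where
    grow : ∀ {a b c n} → a ≤ b + n → b ≤ suc c → a ≤ c + suc n
    grow {c = c} {n} a≤ b≤ = ≤-trans a≤ (≤-trans (+-monoˡ-≤ n b≤) (≤-reflexive (sym (+-suc c n))))

  -- Balance is asked of the left half alone, matching the role of `S` in `Expanding`; `left-large`
  -- derives it from the size of the whole set.
  Expander : Set
  Expander = ∀ χ → M ≤ 4 * # (lefts χ) → M ≤ 4 * # (lefts (not ∘ χ)) → M ≤ 12 * cut χ

  -- Along the matching of colour 0, a right node of the set has its left partner in the set too, or
  -- the edge between them is cut.
  size≤2left+cut : ∀ χ → size χ ≤ 2 * # (lefts χ) + cut χ
  size≤2left+cut χ = ≤-trans (+-monoʳ-≤ l right≤) (≤-trans (≤-reflexive (regroup l _)) (+-monoʳ-≤ (2 * l)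
    (≤-trans (m≤m+n (sum (crossing [] χ 0F)) _) (m≤m+n _ (sum (crossing [] χ 2F))))))
    where
    l : ℕ
    l = # (lefts χ)
    regroup : ∀ l c → l + (l + c) ≡ 2 * l + c
    regroup = solve-∀
    bits : ∀ a b → (if b then 1 else 0) ≤ (if a then 1 else 0) + [ a ≠ b ]
    bits true  b     = ≤-trans (if≤1 b) (m≤m+n 1 _)
    bits false b     = ≤-refl
    right≤ : # (rights χ) ≤ l + sum (crossing [] χ 0F)
    right≤ = ≤-trans (≤-reflexive (sum-permute _ (π 0F))) (≤-trans (sum-mono (λ i → bits (χ (left i)) _))
      (≤-reflexive (sum-distrib-+ (λ i → if χ (left i) then 1 else 0) (crossing [] χ 0F))))

  cut-not : ∀ χ → cut (not ∘ χ) ≡ cut χ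
  cut-not χ = cong₂ _+_ (cong₂ _+_ (colour 0F) (colour 1F)) (colour 2F)
    where
    flip : ∀ a b → [ not a ≠ not b ] ≡ [ a ≠ b ]
    flip true  true  = refl
    flip true  false = refl
    flip false true  = refl
    flip false false = refl
    colour : ∀ c → sum (crossing [] (not ∘ χ) c) ≡ sum (crossing [] χ c)
    colour c = sum-cong-≗ (λ i → flip (χ (left i)) (χ (right (π c ⟨$⟩ʳ i))))

  -- With l left nodes the hypotheses give 4M ≤ 12 l + 12 K ≤ 12 l + M. Two thirds of M thus become
  -- a quarter after all losses of order M/12.
  left-large : ∀ χ K → 12 * K < M → cut χ ≤ K → M + M ≤ 3 * size χ + 3 * K → M ≤ 4 * # (lefts χ)
  left-large χ K 12K<M cut≤K 2M≤ = *-cancelˡ-≤ 3 (+-cancelʳ-≤ M _ _ (begin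
    3 * M + M                       ≡⟨ four M ⟩
    2 * (M + M)                     ≤⟨ *-monoʳ-≤ 2 2M≤ ⟩
    2 * (3 * size χ + 3 * K)        ≤⟨ *-monoʳ-≤ 2 (+-monoˡ-≤ (3 * K) (*-monoʳ-≤ 3 (≤-trans (size≤2left+cut χ) (+-monoʳ-≤ (2 * l) cut≤K)))) ⟩
    2 * (3 * (2 * l + K) + 3 * K)   ≡⟨ collect l K ⟩
    3 * (4 * l) + 12 * K            ≤⟨ +-monoʳ-≤ (3 * (4 * l)) (<⇒≤ 12K<M) ⟩
    3 * (4 * l) + M                 ∎))
    where
    open ≤-Reasoning
    l : ℕ
    l = # (lefts χ)
    four : ∀ M → 3 * M + M ≡ 2 * (M + M)
    four = solve-∀
    collect : ∀ l K → 2 * (3 * (2 * l + K) + 3 * K) ≡ 3 * (4 * l) + 12 * K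
    collect = solve-∀

  -- Mod-2 chains and connectivity away from a set.

  Chain : Set
  Chain = Fin 3 → Fin M → Bool

  ∂ : Chain → Node M → Bool
  ∂ D u = D 0F (edge 0F u) xor (D 1F (edge 1F u) xor D 2F (edge 2F u))

  point : Node M → Node M → Bool
  point u v = does (u ≟ₙ v)

  -- u and v are connected by edges avoiding X, expressed by a mod-2 chain instead of a path.
  record Linked (X : List (Node M)) (u v : Node M) : Set where
    constructor linked
    field
      chain  : Chain
      joins  : ∀ w → ∂ chain w ≡ point u w xor point v w
      avoids : All (λ w → ∀ c → chain c (edge c w) ≡ false) X

  ∂-cong : ∀ (D E : Chain) → (∀ c i → D c i ≡ E c i) → ∀ u → ∂ D u ≡ ∂ E u
  ∂-cong D E D≡E u = cong₂ _xor_ (D≡E 0F _) (cong₂ _xor_ (D≡E 1F _) (D≡E 2F _))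

  _⊕_ : Chain → Chain → Chain
  (D ⊕ E) c i = D c i xor E c i

  ∂-⊕ : ∀ D E u → ∂ (D ⊕ E) u ≡ ∂ D u xor ∂ E u
  ∂-⊕ D E u = regroup (D 0F (edge 0F u)) (E 0F (edge 0F u)) (D 1F (edge 1F u)) (E 1F (edge 1F u)) (D 2F (edge 2F u)) (E 2F (edge 2F u))
    where
    regroup : ∀ a x b y c z → (a xor x) xor ((b xor y) xor (c xor z)) ≡ (a xor (b xor c)) xor (x xor (y xor z))
    regroup a x b y c z = trans (cong ((a xor x) xor_) (xor-interchange b y c z)) (xor-interchange a x (b xor c) (y xor z))

  xor-cancel : ∀ a b c → (a xor b) xor (b xor c) ≡ a xor c
  xor-cancel true  true  c = refl
  xor-cancel true  false c = refl
  xor-cancel false true  c = Bool.not-involutive c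
  xor-cancel false false c = refl

  Linked-refl : ∀ {X} u → Linked X u u
  Linked-refl u = linked (λ _ _ → false) (λ w → sym (xor-same (point u w))) (All.tabulate (λ _ _ → refl))

  Linked-sym : ∀ {X u v} → Linked X u v → Linked X v u
  Linked-sym {u = u} {v} (linked D ∂D avoids) =
    linked D (λ w → trans (∂D w) (xor-comm (point u w) (point v w))) avoids

  Linked-trans : ∀ {X u v w} → Linked X u v → Linked X v w → Linked X u w
  Linked-trans {u = u} {v} {w} (linked D ∂D avD) (linked E ∂E avE) = linked (D ⊕ E)
    (λ x → trans (∂-⊕ D E x) (trans (cong₂ _xor_ (∂D x) (∂E x)) (xor-cancel (point u x) (point v x) (point w x))))
    (All.zipWith (λ (D≡0 , E≡0) c → cong₂ _xor_ (D≡0 c) (E≡0 c)) (avD , avE))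

  Linked-⊆ : ∀ {X Y u v} → X ⊆ Y → Linked Y u v → Linked X u v
  Linked-⊆ X⊆Y (linked D ∂D avoids) = linked D ∂D (anti-mono X⊆Y avoids)

  Linked-edge : ∀ {X} c i → left i ∉ X → right (π c ⟨$⟩ʳ i) ∉ X → Linked X (left i) (right (π c ⟨$⟩ʳ i))
  Linked-edge {X} c i l∉ r∉ = linked D (λ w → trans (∂D w) (ends w)) (All.tabulate avoids)
    where
    D : Chain
    D c′ j = does (c′ Fin.≟ c) ∧ does (j Fin.≟ i)
    pick : ∀ (c : Fin 3) (x : Fin 3 → Bool) →
      (does (0F Fin.≟ c) ∧ x 0F) xor ((does (1F Fin.≟ c) ∧ x 1F) xor (does (2F Fin.≟ c) ∧ x 2F)) ≡ x c
    pick 0F x = xor-identityʳ (x 0F)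
    pick 1F x = xor-identityʳ (x 1F)
    pick 2F x = refl
    ∂D : ∀ w → ∂ D w ≡ does (edge c w Fin.≟ i)
    ∂D w = pick c (λ c′ → does (edge c′ w Fin.≟ i))
    ends : ∀ w → does (edge c w Fin.≟ i) ≡ point (left i) w xor point (right (π c ⟨$⟩ʳ i)) w
    ends (left j)  = trans (does-⇔ (mk⇔ (λ { refl → refl }) (λ { refl → refl })) (j Fin.≟ i) (left i ≟ₙ left j))
      (trans (sym (xor-identityʳ _)) (cong (point (left i) (left j) xor_) (sym (dec-false (right (π c ⟨$⟩ʳ i) ≟ₙ left j) λ()))))
    ends (right j) = trans (does-⇔ (mk⇔ (λ { refl → cong (λ k → right k) (inverseʳ (π c)) }) (λ { refl → inverseˡ (π c) }))
        ((π c ⟨$⟩ˡ j) Fin.≟ i) (right (π c ⟨$⟩ʳ i) ≟ₙ right j))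
      (cong (_xor point (right (π c ⟨$⟩ʳ i)) (right j)) (sym (dec-false (left i ≟ₙ right j) λ())))
    avoids : ∀ {w} → w ∈ X → ∀ c′ → D c′ (edge c′ w) ≡ false
    avoids {w} w∈X c′ with c′ Fin.≟ c
    ... | no _     = refl
    ... | yes refl = dec-false (edge c w Fin.≟ i) (not-edge w w∈X)
      where
      not-edge : ∀ w → w ∈ X → edge c w ≢ i
      not-edge (left j)  w∈X refl = l∉ w∈X
      not-edge (right j) w∈X refl = r∉ (subst (λ k → right k ∈ X) (sym (inverseʳ (π c))) w∈X)

  all-nodes? : ∀ {P : Node M → Set} → (∀ u → Dec (P u)) → Dec (∀ u → P u)
  all-nodes? P? = map′ (λ { (l , r) (left i) → l i ; (l , r) (right i) → r i }) (λ p → (λ i → p (left i)) , (λ i → p (right i)))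
    (Fin.all? (λ i → P? (left i)) ×-dec Fin.all? (λ i → P? (right i)))

  abstract
    -- A chain amounts to three bit vectors, so all chains can be searched; this makes `class` a
    -- Boolean function whose size can be counted.
    Linked? : ∀ X u v → Dec (Linked X u v)
    Linked? X u v = map′ (λ (p , q , r , ∂D , av) → linked (chain p q r) ∂D av)
      (λ (linked D ∂D av) → tabulate (D 0F) , tabulate (D 1F) , tabulate (D 2F) ,
        (λ w → trans (∂-cong (chain _ _ _) D (chain-tabulate D) w) (∂D w)) ,
        All.map (λ D≡0 c → trans (chain-tabulate D c _) (D≡0 c)) av)
      (anySubset? λ p → anySubset? λ q → anySubset? λ r →
        all-nodes? (λ w → ∂ (chain p q r) w Bool.≟ (point u w xor point v w)) ×-dec
        All.all? (λ w → Fin.all? (λ c → chain p q r c (edge c w) Bool.≟ false)) X)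
      where
      chain : Vec Bool M → Vec Bool M → Vec Bool M → Chain
      chain p q r 0F = lookup p
      chain p q r 1F = lookup q
      chain p q r 2F = lookup r
      chain-tabulate : ∀ (D : Chain) c i → chain (tabulate (D 0F)) (tabulate (D 1F)) (tabulate (D 2F)) c i ≡ D c i
      chain-tabulate D 0F i = lookup∘tabulate (D 0F) i
      chain-tabulate D 1F i = lookup∘tabulate (D 1F) i
      chain-tabulate D 2F i = lookup∘tabulate (D 2F) i

  class : List (Node M) → Node M → Node M → Bool
  class X u v = does (Linked? X u v)

  Closed : List (Node M) → (Node M → Bool) → Set
  Closed X χ = ∀ {u v} → Linked X u v → χ u ≡ χ v

  class-closed : ∀ X w → Closed X (class X w)
  class-closed X w {u} {v} u~v = does-⇔ (mk⇔ (λ w~u → Linked-trans w~u u~v) (λ w~v → Linked-trans w~v (Linked-sym u~v)))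
    (Linked? X w u) (Linked? X w v)

  crossings-closed : ∀ X χ → Closed X χ → crossings X χ ≡ 0
  crossings-closed X χ closed = cong₂ _+_ (cong₂ _+_ (colour 0F) (colour 1F)) (colour 2F)
    where
    none : ∀ c i → crossing X χ c i ≡ 0
    none c i with left i ∈? X | right (π c ⟨$⟩ʳ i) ∈? X
    ... | yes _ | _     = refl
    ... | no _  | yes _ = refl
    ... | no l∉ | no r∉ = cong (if_then 1 else 0)
      (trans (cong (_xor χ (right (π c ⟨$⟩ʳ i))) (closed (Linked-edge c i l∉ r∉))) (xor-same (χ (right (π c ⟨$⟩ʳ i)))))
    colour : ∀ c → sum (crossing X χ c) ≡ 0
    colour c = trans (sum-cong-≗ (none c)) (sum-replicate-zero M)

  -- A closed set cuts no edge outside `X`, so `reassign` produces a cut of at most |X| edges. Its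
  -- two sides have lost at most |X| nodes, `left-large` applies to both, and expansion gives M ≤ 12
  -- |X|.
  unbalanced : Expander → ∀ X χ → 12 * length X < M → Closed X χ → M + M ≤ 3 * size χ → 3 * size χ ≤ 2 * (M + M) → ⊥
  unbalanced expander X χ 12X<M closed 2M≤ ≤4M with χ′ , cut≤ , ≤size , size≤ ← reassign X χ =
    <⇒≱ 12X<M (≤-trans (expander χ′ large (left-large (not ∘ χ′) K 12X<M (≤-trans (≤-reflexive (cut-not χ′)) cut≤K) large-not))
      (*-monoʳ-≤ 12 cut≤K))
    where
    K : ℕ
    K = length X
    cut≤K : cut χ′ ≤ K
    cut≤K = ≤-trans cut≤ (≤-reflexive (cong (_+ K) (crossings-closed X χ closed)))
    large : M ≤ 4 * # (lefts χ′)
    large = left-large χ′ K 12X<M cut≤K (≤-trans 2M≤ (≤-trans (*-monoʳ-≤ 3 size≤) (≤-reflexive (*-distribˡ-+ 3 (size χ′) K))))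
    large-not : M + M ≤ 3 * size (not ∘ χ′) + 3 * K
    large-not = +-cancelˡ-≤ (2 * (M + M)) _ _ (begin
      2 * (M + M) + (M + M)                      ≡⟨ three (M + M) ⟩
      3 * (M + M)                                ≡⟨ cong (3 *_) (size-not χ′) ⟨
      3 * (size χ′ + size (not ∘ χ′))            ≤⟨ *-monoʳ-≤ 3 (+-monoˡ-≤ _ ≤size) ⟩
      3 * (size χ + K + size (not ∘ χ′))         ≡⟨ collect (size χ) K _ ⟩
      3 * size χ + (3 * size (not ∘ χ′) + 3 * K) ≤⟨ +-monoˡ-≤ _ ≤4M ⟩
      2 * (M + M) + (3 * size (not ∘ χ′) + 3 * K) ∎)
      where
      open ≤-Reasoning
      three : ∀ x → 2 * x + x ≡ 3 * x
      three = solve-∀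
      collect : ∀ x k y → 3 * (x + k + y) ≡ 3 * x + (3 * y + 3 * k)
      collect = solve-∀

  -- The component containing more than half of all nodes.

  Big : List (Node M) → Node M → Set
  Big X t = M < size (class X t)

  union : List (Node M) → List (Node M) → Node M → Bool
  union X []      u = false
  union X (v ∷ l) u = class X v u ∨ union X l u

  union-closed : ∀ X l → Closed X (union X l)
  union-closed X []      u~v = refl
  union-closed X (w ∷ l) u~v = cong₂ _∨_ (class-closed X w u~v) (union-closed X l u~v)

  union-∈ : ∀ X {l u} → u ∈ l → union X l u ≡ true
  union-∈ X {w ∷ l} {u} (here refl) = cong (_∨ union X l u) (dec-true (Linked? X u u) (Linked-refl u))
  union-∈ X {w ∷ l} {u} (there u∈l) = trans (cong (class X w u ∨_) (union-∈ X u∈l)) (Bool.∨-zeroʳ _)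

  size-false : size (λ (_ : Node M) → false) ≡ 0
  size-false = cong₂ _+_ (sum-replicate-zero M) (sum-replicate-zero M)

  -- If all classes are small, then adding classes one by one passes through the window [2M/3, 4M/3].
  some-big : Expander → 1 ≤ M → ∀ X → 12 * length X < M → ¬ (∀ t → size (class X t) ≤ M)
  some-big expander 1≤M X 12X<M small = <⇒≱ (unions-small (nodes M)) (≤-trans (m≤m+n (M + M) _) (*-monoʳ-≤ 3 (≤-reflexive everything)))
    where
    everything : M + M ≡ size (union X (nodes M))
    everything = sym (cong₂ _+_ (full (λ i → left i)) (full (λ i → right i)))
      where
      full : (f : Fin M → Node M) → # (union X (nodes M) ∘ f) ≡ M
      full f = trans (sum-cong-≗ (λ i → cong (if_then 1 else 0) (union-∈ X (∈-nodes (f i))))) (sum-ones M)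
    unions-small : ∀ l → 3 * size (union X l) < M + M
    unions-small []      = ≤-trans (s≤s (≤-reflexive (cong (3 *_) size-false))) (≤-trans 1≤M (m≤m+n M M))
    unions-small (v ∷ l) = ≰⇒> λ large → unbalanced expander X (union X (v ∷ l)) 12X<M (union-closed X (v ∷ l)) large (begin
      3 * size (union X (v ∷ l))                    ≤⟨ *-monoʳ-≤ 3 (size-∨ (class X v) (union X l)) ⟩
      3 * (size (class X v) + size (union X l))     ≡⟨ *-distribˡ-+ 3 (size (class X v)) _ ⟩
      3 * size (class X v) + 3 * size (union X l)   ≤⟨ +-mono-≤ (<⇒≤ class-small) (<⇒≤ (unions-small l)) ⟩
      M + M + (M + M)                               ≡⟨ double (M + M) ⟩
      2 * (M + M)                                   ∎)
      where
      open ≤-Reasoning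
      double : ∀ x → x + x ≡ 2 * x
      double = solve-∀
      triple : ∀ x → 3 * x + x ≡ 2 * (x + x)
      triple = solve-∀
      -- A class of size at most M lies below 4M/3, so it cannot reach 2M/3 either. Hence adding it
      -- to a union below 2M/3 cannot jump over the window.
      class-small : 3 * size (class X v) < M + M
      class-small = ≰⇒> λ large → unbalanced expander X (class X v) 12X<M (class-closed X v) large
        (≤-trans (*-monoʳ-≤ 3 (small v)) (≤-trans (m≤m+n (3 * M) M) (≤-reflexive (triple M))))

  any-node? : ∀ {P : Node M → Set} → (∀ u → Dec (P u)) → Dec (∃ P)
  any-node? P? = map′ (λ { (inj₁ (i , p)) → left i , p ; (inj₂ (i , p)) → right i , p })
    (λ { (left i , p) → inj₁ (i , p) ; (right i , p) → inj₂ (i , p) })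
    (Fin.any? (λ i → P? (left i)) ⊎-dec Fin.any? (λ i → P? (right i)))

  abstract
    -- A haven in the sense of cops-and-robber games: the big component is the safe place against
    -- the pebbled set `X`, and `Big-⊆` with `Big-linked` makes these places consistent.
    haven : Expander → ∀ X → 12 * length X < M → ∃ (Big X)
    haven expander X 12X<M with any-node? (λ t → M <? size (class X t))
    ... | yes big  = big
    ... | no  none = contradiction (λ t → ≮⇒≥ (λ big → none (t , big))) (some-big expander (≤-trans (s≤s z≤n) 12X<M) X 12X<M)

  Big-⊆ : ∀ {X Y t} → X ⊆ Y → Big Y t → Big X t
  Big-⊆ {X} {Y} {t} X⊆Y big = <-≤-trans big (size-mono λ u → imply (Linked? Y t u) (Linked? X t u) (Linked-⊆ X⊆Y))
    where
    imply : ∀ {P Q : Set} (p? : Dec P) (q? : Dec Q) → (P → Q) → (if does p? then 1 else 0) ≤ (if does q? then 1 else 0)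
    imply (no _)  q? f = z≤n
    imply (yes p) q? f = ≤-reflexive (cong (if_then 1 else 0) (sym (dec-true q? (f p))))

  abstract
    -- Two classes with more than half of the 2M nodes each must share a node.
    Big-linked : ∀ {X s t} → Big X s → Big X t → Linked X s t
    Big-linked {X} {s} {t} big-s big-t with any-node? (λ u → Linked? X s u ×-dec Linked? X t u)
    ... | yes (u , s~u , t~u) = Linked-trans s~u (Linked-sym t~u)
    ... | no  disjoint = contradiction (+-mono-≤ big-s big-t) (<⇒≱ (s≤s (begin
      size (class X s) + size (class X t)         ≤⟨ +-monoʳ-≤ (size (class X s)) (size-mono exclusive) ⟩
      size (class X s) + size (not ∘ class X s)   ≡⟨ size-not (class X s) ⟩
      M + M                                       ≤⟨ +-monoʳ-≤ M (n≤1+n M) ⟩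
      M + suc M                                   ∎)))
      where
      open ≤-Reasoning
      exclusive : ∀ u → (if class X t u then 1 else 0) ≤ (if not (class X s u) then 1 else 0)
      exclusive u = exclude (Linked? X s u) (Linked? X t u) (λ s~u t~u → disjoint (u , s~u , t~u))
        where
        exclude : ∀ {P Q : Set} (p? : Dec P) (q? : Dec Q) → (P → ¬ Q) → (if does q? then 1 else 0) ≤ (if not (does p?) then 1 else 0)
        exclude p?      (no _)  ¬pq = z≤n
        exclude (no _)  (yes _) ¬pq = ≤-refl
        exclude (yes p) (yes q) ¬pq = contradiction q (¬pq p)

  -- A chain may use none of the three edges at a node of `X`, so its boundary vanishes there; such
  -- a node is linked only to itself, and a class of one node is not big.
  Big-∉ : ∀ {X t} → Big X t → t ∉ X
  Big-∉ {X} {t} big t∈X = contradiction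
    (≤-trans big (≤-trans (size-replace (λ _ → false) (class X t) t alone) (≤-reflexive (cong suc size-false))))
    (<⇒≱ (s≤s (nonempty (proj₁ t))))
    where
    nonempty : ∀ {n} → Fin n → 1 ≤ n
    nonempty zero    = s≤s z≤n
    nonempty (suc _) = s≤s z≤n
    alone : ∀ u → u ≢ t → class X t u ≡ false
    alone u u≢t = dec-false (Linked? X t u) λ (linked D ∂D avoids) → contradiction
      (trans (sym (cong₂ _xor_ (All.lookup avoids t∈X 0F) (cong₂ _xor_ (All.lookup avoids t∈X 1F) (All.lookup avoids t∈X 2F))))
        (trans (∂D t) (cong₂ _xor_ (dec-true (t ≟ₙ t) refl) (dec-false (u ≟ₙ t) u≢t)))) λ()

-- From expanding codes to an expander.

#-count : ∀ {n} (f : Fin n → Bool) → count true (tabulate f) ≡ # f × count false (tabulate f) ≡ # (not ∘ f)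
#-count {zero}  f = refl , refl
#-count {suc n} f with f zero | #-count (f ∘ suc)
... | true  | t , f′ = cong suc t , f′
... | false | t , f′ = t , cong suc f′

ham-tabulate : ∀ {n} (f g : Fin n → Bool) → ham (tabulate f) (tabulate g) ≡ sum (λ i → [ f i ≠ g i ])
ham-tabulate {zero}  f g = refl
ham-tabulate {suc n} f g = cong ([ f zero ≠ g zero ] +_) (ham-tabulate (f ∘ suc) (g ∘ suc))

preimage-tabulate : ∀ {n} (c : Code n) (g : Fin n → Bool) → preimage c (tabulate g) ≡ tabulate (λ i → g (perm c ⟨$⟩ʳ i))
preimage-tabulate c g = trans (sym (tabulate∘lookup (preimage c (tabulate g))))
  (tabulate-cong (λ i → trans (lookup-preimage c (tabulate g) i) (lookup∘tabulate g (perm c ⟨$⟩ʳ i))))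

expander-exists : ∀ M → 108 ≤ M → ∃ λ (π : Fin 3 → Permutation′ M) → BaseGraph.Expander π
expander-exists M 108≤M = build (M / 12 ∸ 9) (M % 12) (m%n<n M 12)
  (trans (m≡m%n+[m/n]*n M 12) (cong (λ q → M % 12 + q * 12) (sym (m+[n∸m]≡n (/-monoˡ-≤ 12 108≤M)))))
  where
  build : ∀ {N₀} p r → r < 12 → N₀ ≡ r + (9 + p) * 12 → ∃ λ (π : Fin 3 → Permutation′ N₀) → BaseGraph.Expander π
  build p r r<12 refl with c , d , expanding ← expanding-codes p r r<12 = π , expands
    where
    q N : ℕ
    q = 9 + p
    N = r + q * 12
    π : Fin 3 → Permutation′ N
    -- Numbering the right nodes suitably makes the first matching the identity.
    π 0F = idₚ
    π 1F = perm c
    π 2F = perm d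
    open BaseGraph π using (Expander; cut)
    third : ∀ {x} → N ≤ 4 * x → 3 * q ≤ x
    third {x} M≤4x = *-cancelˡ-≤ 4 (≤-trans (≤-reflexive (twelve q)) (≤-trans (m≤n+m (q * 12) r) M≤4x))
      where
      twelve : ∀ q → 4 * (3 * q) ≡ q * 12
      twelve = solve-∀
    expands : Expander
    -- The cut exceeds q, hence 12 times the cut is at least 12 (q + 1), which exceeds r + 12 q
    -- because r < 12.
    expands χ large large-not = ≤-trans (≤-trans (+-monoˡ-≤ (q * 12) (<⇒≤ r<12)) (≤-reflexive (*-comm (suc q) 12)))
      (*-monoʳ-≤ 12 (subst (q <_) (cong₂ _+_ (cong₂ _+_ (ham-tabulate f g) (colour c)) (colour d))
        (expanding (tabulate f) (tabulate g)
          (≤-trans (third large) (≤-reflexive (sym (proj₁ (#-count f)))))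
          (≤-trans (third large-not) (≤-reflexive (sym (proj₂ (#-count f))))))))
      where
      f g : Fin N → Bool
      f = lefts χ
      g = rights χ
      colour : ∀ c → ham (tabulate f) (preimage c (tabulate g)) ≡ sum (λ i → [ f i ≠ g (perm c ⟨$⟩ʳ i) ])
      colour c = trans (cong (ham (tabulate f)) (preimage-tabulate c g)) (ham-tabulate f (λ i → g (perm c ⟨$⟩ʳ i)))

-- Cai-Fürer-Immerman graphs and their edge flips.

module CFI {M : ℕ} (π : Fin 3 → Permutation′ M) {n : ℕ} (coordinates : Fin n ↔ (Node M × (Bool × Bool))) where

  open BaseGraph π
  open Inverse coordinates using () renaming (to to coord; from to vertex)

  coord-vertex : ∀ p → coord (vertex p) ≡ p
  coord-vertex p = Inverse.inverseˡ coordinates refl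

  vertex-coord : ∀ x → vertex (coord x) ≡ x
  vertex-coord x = Inverse.inverseʳ coordinates refl

  node : Fin n → Node M
  node x = proj₁ (coord x)

  -- A vertex over u assigns bits to the three edges at u; the third bit makes their sum the charge τ u.
  bits : (Node M → Bool) → Node M × (Bool × Bool) → Fin 3 → Bool
  bits τ (u , x , y) 0F = x
  bits τ (u , x , y) 1F = y
  bits τ (u , x , y) 2F = x xor (y xor τ u)

  consistent : (Node M → Bool) → (p q : Node M × (Bool × Bool)) → Fin 3 → Bool
  consistent τ p q c = not (does (edge c (proj₁ p) Fin.≟ edge c (proj₁ q))) ∨ not (bits τ p c xor bits τ q c)

  compatible joined : (Node M → Bool) → (p q : Node M × (Bool × Bool)) → Bool
  compatible τ p q = consistent τ p q 0F ∧ (consistent τ p q 1F ∧ consistent τ p q 2F)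
  joined τ p q = not (point (proj₁ p) (proj₁ q)) ∧ compatible τ p q

  cfi : (Node M → Bool) → Graph n
  cfi τ = record
    { adj    = λ x y → joined τ (coord x) (coord y)
    ; sym    = λ x y → joined-sym (coord x) (coord y)
    ; irrefl = λ x → cong (λ b → not b ∧ compatible τ (coord x) (coord x)) (dec-true (node x ≟ₙ node x) refl)
    }
    where
    consistent-sym : ∀ p q c → consistent τ p q c ≡ consistent τ q p c
    consistent-sym p q c = cong₂ (λ a b → not a ∨ not b)
      (does-⇔ (mk⇔ sym sym) (edge c (proj₁ p) Fin.≟ edge c (proj₁ q)) (edge c (proj₁ q) Fin.≟ edge c (proj₁ p)))
      (xor-comm (bits τ p c) (bits τ q c))
    joined-sym : ∀ p q → joined τ p q ≡ joined τ q p
    joined-sym p q = cong₂ _∧_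
      (cong not (does-⇔ (mk⇔ sym sym) (proj₁ p ≟ₙ proj₁ q) (proj₁ q ≟ₙ proj₁ p)))
      (cong₂ _∧_ (consistent-sym p q 0F) (cong₂ _∧_ (consistent-sym p q 1F) (consistent-sym p q 2F)))

  toggle : Chain → Node M × (Bool × Bool) → Node M × (Bool × Bool)
  toggle F (u , x , y) = u , x xor F 0F (edge 0F u) , y xor F 1F (edge 1F u)

  move : Chain → Fin n → Fin n
  move F x = vertex (toggle F (coord x))

  coord-move : ∀ F x → coord (move F x) ≡ toggle F (coord x)
  coord-move F x = coord-vertex (toggle F (coord x))

  node-move : ∀ F x → node (move F x) ≡ node x
  node-move F x = cong proj₁ (coord-move F x)

  AgreeAt : Chain → Chain → Node M → Set
  AgreeAt F E u = ∀ c → F c (edge c u) ≡ E c (edge c u)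

  move-cong : ∀ F E x → AgreeAt F E (node x) → move F x ≡ move E x
  move-cong F E x F≡E = cong vertex (cong₂ (λ a b → node x , proj₁ (proj₂ (coord x)) xor a , proj₂ (proj₂ (coord x)) xor b) (F≡E 0F) (F≡E 1F))

  move-involutive : ∀ F x → move F (move F x) ≡ x
  move-involutive F x = trans (cong (vertex ∘ toggle F) (coord-move F x)) (trans (cong vertex (toggle-involutive (coord x))) (vertex-coord x))
    where
    xor-twice : ∀ a b → (a xor b) xor b ≡ a
    xor-twice a b = trans (Bool.xor-assoc a b b) (trans (cong (a xor_) (xor-same b)) (xor-identityʳ a))
    toggle-involutive : ∀ p → toggle F (toggle F p) ≡ p
    toggle-involutive (u , x , y) = cong₂ (λ a b → u , a , b) (xor-twice x _) (xor-twice y _)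

  move-injective : ∀ F {x y} → move F x ≡ move F y → x ≡ y
  move-injective F {x} {y} eq = trans (sym (move-involutive F x)) (trans (cong (move F) eq) (move-involutive F y))

  -- Different vertices may be moved by different chains provided the chain depends only on the
  -- node: `move` stays over its node, so moving twice uses the same chain and cancels.
  move↔ : (Node M → Chain) → Fin n ↔ Fin n
  move↔ Φ = mk↔ₛ′ f f f-involutive f-involutive
    where
    f : Fin n → Fin n
    f x = move (Φ (node x)) x
    f-involutive : ∀ x → f (f x) ≡ x
    f-involutive x = trans (cong (λ u → move (Φ u) (f x)) (node-move (Φ (node x)) x)) (move-involutive (Φ (node x)) x)

  -- `toggle` touches only the two stored bits. The third is determined by the charge, and it flips
  -- by `F` exactly because the charge changes by `∂ F`.
  bits-toggle : ∀ τ τ′ F p → τ′ (proj₁ p) ≡ τ (proj₁ p) xor ∂ F (proj₁ p) →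
    ∀ c → bits τ′ (toggle F p) c ≡ bits τ p c xor F c (edge c (proj₁ p))
  bits-toggle τ τ′ F p@(u , x , y) charge 0F = refl
  bits-toggle τ τ′ F p@(u , x , y) charge 1F = refl
  bits-toggle τ τ′ F p@(u , x , y) charge 2F = begin
    (x xor f) xor ((y xor g) xor τ′ u)                       ≡⟨ cong (λ t → (x xor f) xor ((y xor g) xor t)) charge ⟩
    (x xor f) xor ((y xor g) xor (τ u xor (f xor (g xor h)))) ≡⟨ cong ((x xor f) xor_) (xor-interchange y g (τ u) _) ⟩
    (x xor f) xor ((y xor τ u) xor (g xor (f xor (g xor h)))) ≡⟨ cong (λ z → (x xor f) xor ((y xor τ u) xor z)) (drop₂ f g h) ⟩
    (x xor f) xor ((y xor τ u) xor (f xor h))                ≡⟨ xor-interchange x f (y xor τ u) _ ⟩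
    (x xor (y xor τ u)) xor (f xor (f xor h))                ≡⟨ cong ((x xor (y xor τ u)) xor_) (drop₁ f h) ⟩
    (x xor (y xor τ u)) xor h                                ∎
    where
    open ≡-Reasoning
    f g h : Bool
    f = F 0F (edge 0F u)
    g = F 1F (edge 1F u)
    h = F 2F (edge 2F u)
    drop₁ : ∀ f h → f xor (f xor h) ≡ h
    drop₁ true  h = Bool.not-involutive h
    drop₁ false h = refl
    drop₂ : ∀ f g h → g xor (f xor (g xor h)) ≡ f xor h
    drop₂ true  true  h = cong not (Bool.not-involutive h)
    drop₂ true  false h = refl
    drop₂ false true  h = Bool.not-involutive h
    drop₂ false false h = refl

  -- Both ends of a shared edge are flipped by the same value of `F`, so whether they agree is
  -- unchanged. Thus a chain acts as an isomorphism wherever its boundary accounts for the change of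
  -- charge.
  joined-toggle : ∀ τ τ′ F p q → τ′ (proj₁ p) ≡ τ (proj₁ p) xor ∂ F (proj₁ p) → τ′ (proj₁ q) ≡ τ (proj₁ q) xor ∂ F (proj₁ q) →
    joined τ′ (toggle F p) (toggle F q) ≡ joined τ p q
  joined-toggle τ τ′ F p q cp cq = cong (not (point (proj₁ p) (proj₁ q)) ∧_) (cong₂ _∧_ (same 0F) (cong₂ _∧_ (same 1F) (same 2F)))
    where
    cancel : ∀ a b f → (a xor f) xor (b xor f) ≡ a xor b
    cancel a b f = trans (xor-interchange a f b f) (trans (cong ((a xor b) xor_) (xor-same f)) (xor-identityʳ (a xor b)))
    same : ∀ c → consistent τ′ (toggle F p) (toggle F q) c ≡ consistent τ p q c
    same c with edge c (proj₁ p) Fin.≟ edge c (proj₁ q)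
    ... | no _   = refl
    ... | yes eq = cong not (trans (cong₂ _xor_ (bits-toggle τ τ′ F p cp c)
      (trans (bits-toggle τ τ′ F q cq c) (cong (λ i → bits τ q c xor F c i) (sym eq)))) (cancel (bits τ p c) (bits τ q c) _))

  -- Duplicator's strategy.

  module Strategy (expander : Expander) (t₀ : Node M) (big₀ : Big [] t₀) where

    G H : Graph n
    G = cfi (λ _ → false)
    H = cfi (point t₀)

    -- Duplicator's secret isomorphism away from the twist: toggling the flips moves the charge from t₀ to the twist.
    record State (X : List (Node M)) : Set where
      field
        flips     : Chain
        twist     : Node M
        twist-big : Big X twist
        boundary  : ∀ u → ∂ flips u ≡ point t₀ u xor point twist u

      charge : ∀ {u} → u ∈ X → point t₀ u ≡ false xor ∂ flips u
      charge {u} u∈X = sym (trans (boundary u) (trans (cong (point t₀ u xor_)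
        (dec-false (twist ≟ₙ u) (λ { refl → Big-∉ twist-big u∈X }))) (xor-identityʳ _)))

      adj-move : ∀ x y → node x ∈ X → node y ∈ X → adj H (move flips x) (move flips y) ≡ adj G x y
      adj-move x y x∈X y∈X = trans (cong₂ (joined (point t₀)) (coord-move flips x) (coord-move flips y))
        (joined-toggle (λ _ → false) (point t₀) flips (coord x) (coord y) (charge x∈X) (charge y∈X))

    open State

    -- Nodes that are big for `X` and for the empty list are both big for the empty list, so a chain
    -- leads the charge from `t₀` to the safe component.
    initial : ∀ X → 12 * length X < M → State X
    initial X few with t , big ← haven expander X few with linked F ∂F _ ← Big-linked big₀ (Big-⊆ (λ ()) big) =
      record { flips = F ; twist = t ; twist-big = big ; boundary = ∂F }

    restrict : ∀ {X Y} → X ⊆ Y → State Y → State X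
    restrict X⊆Y s = record { flips = flips s ; twist = twist s ; twist-big = Big-⊆ X⊆Y (twist-big s) ; boundary = boundary s }

    -- The old and the new twist are both big for `X`, so the charge travels along a chain that uses
    -- no edge at `X`. The flips there are unchanged and all earlier answers stay valid.
    extend : ∀ {X} (s : State X) v → 12 * suc (length X) < M →
      Σ (State (v ∷ X)) λ s′ → All (AgreeAt (flips s) (flips s′)) X
    extend {X} s v few with t , big ← haven expander (v ∷ X) few with linked D ∂D avoids ← Big-linked (twist-big s) (Big-⊆ there big) =
      record
        { flips     = flips s ⊕ D
        ; twist     = t
        ; twist-big = big
        ; boundary  = λ u → trans (∂-⊕ (flips s) D u) (trans (cong₂ _xor_ (boundary s u) (∂D u))
                        (xor-cancel (point t₀ u) (point (twist s) u) (point t u)))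
        } ,
      All.map (λ D≡0 c → sym (trans (cong (flips s c _ xor_) (D≡0 c)) (xor-identityʳ _))) avoids

    nodesOf : ∀ {k} → Vec (Fin n) k → List (Node M)
    nodesOf a = toList (Vec.map node a)

    length-nodesOf : ∀ {k} (a : Vec (Fin n) k) → length (nodesOf a) ≡ k
    length-nodesOf a = length-toList (Vec.map node a)

    ∈-nodesOf : ∀ {k} (a : Vec (Fin n) k) i → node (lookup a i) ∈ nodesOf a
    ∈-nodesOf (x ∷ a) zero    = here refl
    ∈-nodesOf (x ∷ a) (suc i) = there (∈-nodesOf a i)

    nodesOf-[]≔ : ∀ {k} (a : Vec (Fin n) k) i w → nodesOf (a [ i ]≔ w) ⊆ node w ∷ nodesOf a
    nodesOf-[]≔ (x ∷ a) zero    w (here eq)  = here eq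
    nodesOf-[]≔ (x ∷ a) zero    w (there u∈) = there (there u∈)
    nodesOf-[]≔ (x ∷ a) (suc i) w (here eq)  = there (here eq)
    nodesOf-[]≔ (x ∷ a) (suc i) w (there u∈) with nodesOf-[]≔ a i w u∈
    ... | here eq   = here eq
    ... | there u∈′ = there (there u∈′)

    map-move-cong : ∀ F E {k} (a : Vec (Fin n) k) → All (AgreeAt F E) (nodesOf a) → Vec.map (move F) a ≡ Vec.map (move E) a
    map-move-cong F E []      []           = refl
    map-move-cong F E (x ∷ a) (F≡E ∷ rest) = cong₂ _∷_ (move-cong F E x F≡E) (map-move-cong F E a rest)

    -- The reply to `w` is computed with all k old nodes still present, which is why k + 1 nodes are
    -- needed. It does not depend on the coordinate to be replaced, so one bijection serves every
    -- `i`; only then is the old entry forgotten by `restrict`.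
    duplicator : ∀ r {k} (a : Vec (Fin n) k) (s : State (nodesOf a)) → 12 * suc k < M →
      sameWL G H r a (Vec.map (move (flips s)) a)
    duplicator zero a s few i j
      rewrite lookup-map i (move (flips s)) a | lookup-map j (move (flips s)) a =
      mk⇔ (cong (move (flips s))) (move-injective (flips s)) ,
      sym (adj-move s (lookup a i) (lookup a j) (∈-nodesOf a i) (∈-nodesOf a j))
    duplicator (suc r) {k} a s few = duplicator r a s few , move↔ (λ v → flips (proj₁ (next v))) , (λ w i → reply w i (next (node w)))
      where
      next : ∀ v → Σ (State (v ∷ nodesOf a)) λ s′ → All (AgreeAt (flips s) (flips s′)) (nodesOf a)
      next v = extend s v (subst (λ l → 12 * suc l < M) (sym (length-nodesOf a)) few)
      reply : ∀ w i ((s′ , _) : Σ (State (node w ∷ nodesOf a)) λ s′ → All (AgreeAt (flips s) (flips s′)) (nodesOf a)) →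
        sameWL G H r (a [ i ]≔ w) (Vec.map (move (flips s)) a [ i ]≔ move (flips s′) w)
      reply w i (s′ , agree′) = subst (sameWL G H r (a [ i ]≔ w))
        (trans (map-[]≔ (move (flips s′)) a i) (cong (_[ i ]≔ move (flips s′) w) (sym (map-move-cong (flips s) (flips s′) a agree′))))
        (duplicator r (a [ i ]≔ w) (restrict (nodesOf-[]≔ a i w) s′) few)

    Nbr-↔ : ∀ {v u} (p : Fin n ↔ Fin n) → (∀ w → adj H u (Inverse.to p w) ≡ adj G v w) → Nbr G v ↔ Nbr H u
    Nbr-↔ {v} {u} p preserves = mk↔ₛ′
      (λ (w , vw) → Inverse.to p w , subst T (sym (preserves w)) vw)
      (λ (w , uw) → Inverse.from p w , subst T (trans (cong (adj H u) (sym (Inverse.inverseˡ p refl))) (preserves (Inverse.from p w))) uw)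
      (λ (w , uw) → Nbr-≡ H (Inverse.inverseˡ p refl))
      (λ (w , vw) → Nbr-≡ G (Inverse.inverseʳ p refl))
      where
      Nbr-≡ : ∀ (K : Graph n) {v} {x y : Nbr K v} → proj₁ x ≡ proj₁ y → x ≡ y
      Nbr-≡ K refl = cong (_ ,_) (Bool.T-irrelevant _ _)

    -- Colour refinement walks along edges: `v` and its neighbour `w` are held together for one
    -- round to match adjacency, then `v` is dropped.
    duplicator₁ : ∀ r v (s : State (node v ∷ [])) → 12 * 2 < M → sameCR G H r v (move (flips s) v)
    duplicator₁ zero    v s few = tt
    duplicator₁ (suc r) v s few = duplicator₁ r v s few , Nbr-↔ (move↔ (λ u → flips (proj₁ (next u)))) (λ w → preserves w (next (node w))) ,
      λ (w , _) → duplicator₁ r w (restrict (λ { (here eq) → here eq }) (proj₁ (next (node w)))) few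
      where
      next : ∀ u → Σ (State (u ∷ node v ∷ [])) λ s′ → All (AgreeAt (flips s) (flips s′)) (node v ∷ [])
      next u = extend s u few
      preserves : ∀ w ((s′ , _) : Σ (State (node w ∷ node v ∷ [])) λ s′ → All (AgreeAt (flips s) (flips s′)) (node v ∷ [])) →
        adj H (move (flips s) v) (move (flips s′) w) ≡ adj G v w
      preserves w (s′ , agree′ ∷ []) =
        trans (cong (λ x → adj H x (move (flips s′) w)) (move-cong (flips s) (flips s′) v agree′)) (adj-move s′ v w (there (here refl)) (here refl))

    equivalent : ∀ k → 12 * suc k < M → WLEquiv k G H
    equivalent zero          few = tt
    equivalent (suc zero)    few r = move↔ (λ u → flips (start u)) , λ v → duplicator₁ r v (start (node v)) few
      where
      start : ∀ u → State (u ∷ [])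
      start u = initial (u ∷ []) (≤-<-trans (*-monoʳ-≤ 12 (n≤1+n 1)) few)
    equivalent (suc (suc m)) few r = mk↔ₛ′ σ σ σ-involutive σ-involutive , λ a → duplicator r a (start (Vec.map node a)) few
      where
      k : ℕ
      k = suc (suc m)
      start : ∀ (U : Vec (Node M) k) → State (toList U)
      start U = initial (toList U) (≤-<-trans (*-monoʳ-≤ 12 (≤-trans (≤-reflexive (length-toList U)) (n≤1+n k))) few)
      -- The chain depends only on the nodes of the tuple, which moving preserves; hence `σ` is an
      -- involution and in particular a bijection.
      σ : Vec (Fin n) k → Vec (Fin n) k
      σ a = Vec.map (move (flips (start (Vec.map node a)))) a
      nodes-move : ∀ F (a : Vec (Fin n) k) → Vec.map node (Vec.map (move F) a) ≡ Vec.map node a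
      nodes-move F a = trans (sym (map-∘ node (move F) a)) (map-cong (node-move F) a)
      σ-involutive : ∀ a → σ (σ a) ≡ a
      σ-involutive a = trans (cong (λ U → Vec.map (move (flips (start U))) (σ a)) (nodes-move F a))
        (trans (sym (map-∘ (move F) (move F) a)) (trans (map-cong (move-involutive F) a) (map-id a)))
        where
        F : Chain
        F = flips (start (Vec.map node a))

-- Non-isomorphism by parity.

module ⊕ = Sum (CommutativeRing.+-commutativeMonoid xor-∧-commutativeRing)

injective⇒surjective : ∀ {n} (f : Fin n → Fin n) → Injective _≡_ _≡_ f → ∀ y → ∃ λ x → f x ≡ y
injective⇒surjective {suc n} f f-injective y with Fin.any? (λ x → f x Fin.≟ y)
... | yes hit  = hit
... | no  miss = contradiction (Fin.injective⇒≤ {f = λ x → punchOut (y≢ x)}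
  (λ {x} {x′} eq → f-injective (Fin.punchOut-injective (y≢ x) (y≢ x′) eq))) 1+n≰n
  where
  y≢ : ∀ x → y ≢ f x
  y≢ x y≡fx = miss (x , sym y≡fx)

Node↔Fin : ∀ {M} → Node M ↔ Fin (M * 2)
Node↔Fin {M} = ↔-sym (Fin.*↔× {M} {2}) ↔-∘ (↔-id (Fin M) ×-↔ ↔-sym Fin.2↔Bool)

Node-injective⇒surjective : ∀ {M} (f : Node M → Node M) → (∀ {u v} → f u ≡ f v → u ≡ v) → ∀ y → ∃ λ x → f x ≡ y
Node-injective⇒surjective {M} f f-injective y = from (proj₁ hit) , to-injective (proj₂ hit)
  where
  open Inverse (Node↔Fin {M}) using (to; from; strictlyInverseˡ; strictlyInverseʳ)
  to-injective : ∀ {u v} → to u ≡ to v → u ≡ v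
  to-injective {u} {v} eq = trans (sym (strictlyInverseʳ u)) (trans (cong from eq) (strictlyInverseʳ v))
  from-injective : ∀ {i j} → from i ≡ from j → i ≡ j
  from-injective {i} {j} eq = trans (sym (strictlyInverseˡ i)) (trans (cong to eq) (strictlyInverseˡ j))
  hit : ∃ λ i → to (f (from i)) ≡ to y
  hit = injective⇒surjective (to ∘ f ∘ from) (from-injective ∘ f-injective ∘ to-injective) (to y)

⊕-false : ∀ n → ⊕.sum {n} (λ _ → false) ≡ false
⊕-false zero    = refl
⊕-false (suc n) = ⊕-false n

⊕-single : ∀ {n} (k : Fin n) → ⊕.sum (λ i → does (k Fin.≟ i)) ≡ true
⊕-single {suc n} zero    = cong not (⊕-false n)
⊕-single {suc n} (suc k) = ⊕-single k

module _ {M : ℕ} (π : Fin 3 → Permutation′ M) where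

  open BaseGraph π

  -- The handshake lemma in bipartite form: each edge of the chain has one left and one right end,
  -- so both sides sum to the parity of the chain.
  ⊕-∂ : ∀ D → ⊕.sum (lefts (∂ D)) ≡ ⊕.sum (rights (∂ D))
  ⊕-∂ D = trans (split (λ c i → D c i)) (trans (cong₂ _xor_ (colour 0F) (cong₂ _xor_ (colour 1F) (colour 2F)))
    (sym (split (λ c j → D c (π c ⟨$⟩ˡ j)))))
    where
    split : ∀ (E : Fin 3 → Fin M → Bool) →
      ⊕.sum (λ i → E 0F i xor (E 1F i xor E 2F i)) ≡ ⊕.sum (E 0F) xor (⊕.sum (E 1F) xor ⊕.sum (E 2F))
    split E = trans (⊕.∑-distrib-+ (E 0F) (λ i → E 1F i xor E 2F i)) (cong (⊕.sum (E 0F) xor_) (⊕.∑-distrib-+ (E 1F) (E 2F)))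
    colour : ∀ c → ⊕.sum (D c) ≡ ⊕.sum (λ j → D c (π c ⟨$⟩ˡ j))
    colour c = ⊕.sum-permute (D c) (↔-sym (π c))

  same-side : ∀ k b → ⊕.sum (λ i → point (k , b) (i , b)) ≡ true
  same-side k b = trans (⊕.sum-cong-≗ (λ i → does-⇔ (mk⇔ (cong proj₁) (cong (_, b))) ((k , b) ≟ₙ (i , b)) (k Fin.≟ i))) (⊕-single k)

  other-side : ∀ k {b b′} → b ≢ b′ → ⊕.sum (λ i → point (k , b) (i , b′)) ≡ false
  other-side k b≢b′ = trans (⊕.sum-cong-≗ (λ i → dec-false ((k , _) ≟ₙ (i , _)) (b≢b′ ∘ cong proj₂))) (⊕-false M)

  -- A single charged node is odd on its own side and even on the other.
  ∂≢point : ∀ D t → ¬ (∀ u → ∂ D u ≡ point t u)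
  ∂≢point D t ∂D≡t = contradiction (trans (sym (⊕.sum-cong-≗ (λ i → ∂D≡t (left i))))
    (trans (⊕-∂ D) (⊕.sum-cong-≗ (λ i → ∂D≡t (right i))))) (one-side t)
    where
    one-side : ∀ t → ⊕.sum (λ i → point t (left i)) ≢ ⊕.sum (λ i → point t (right i))
    one-side (left k)  eq = contradiction (trans (sym (same-side k true)) (trans eq (other-side k λ()))) λ()
    one-side (right k) eq = contradiction (trans (sym (same-side k false)) (trans (sym eq) (other-side k λ()))) λ()

module _ {M : ℕ} (π : Fin 3 → Permutation′ M) {n : ℕ} (coordinates : Fin n ↔ (Node M × (Bool × Bool))) where

  open BaseGraph π
  open CFI π coordinates

  -- The uncharged graph has a clique with one vertex over every node. A clique of that size in
  -- the charged graph would be a chain with boundary t₀, contradicting the handshake lemma.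
  cfi-nonisomorphic : ∀ t₀ → ¬ Iso (cfi (λ _ → false)) (cfi (point t₀))
  cfi-nonisomorphic t₀ (f , preserves) = ∂≢point π D t₀ ∂D
    where
    τ : Node M → Bool
    τ = point t₀
    zeros : Node M → Fin n
    zeros u = Inverse.from coordinates (u , false , false)
    image-of : Node M → Fin n
    image-of u = Inverse.to f (zeros u)
    zeros-joined : ∀ {u v} → u ≢ v → adj (cfi (λ _ → false)) (zeros u) (zeros v) ≡ true
    zeros-joined {u} {v} u≢v = trans (cong₂ (joined (λ _ → false)) (coord-vertex _) (coord-vertex _))
      (cong₂ (λ a b → not a ∧ b) (dec-false (u ≟ₙ v) u≢v) (cong₂ _∧_ (ok 0F) (cong₂ _∧_ (ok 1F) (ok 2F))))
      where
      zero-bits : ∀ u c → bits (λ _ → false) (u , false , false) c ≡ false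
      zero-bits u 0F = refl
      zero-bits u 1F = refl
      zero-bits u 2F = refl
      ok : ∀ c → consistent (λ _ → false) (u , false , false) (v , false , false) c ≡ true
      ok c = trans (cong (λ b → not (does (edge c u Fin.≟ edge c v)) ∨ not b) (cong₂ _xor_ (zero-bits u c) (zero-bits v c))) (Bool.∨-zeroʳ _)
    clique : ∀ {u v} → u ≢ v → joined τ (Inverse.to coordinates (image-of u)) (Inverse.to coordinates (image-of v)) ≡ true
    clique {u} {v} u≢v = trans (preserves (zeros u) (zeros v)) (zeros-joined u≢v)
    joined⇒≢ : ∀ p q → joined τ p q ≡ true → proj₁ p ≢ proj₁ q
    joined⇒≢ p q adjacent eq = contradiction
      (trans (sym adjacent) (cong (λ b → not b ∧ compatible τ p q) (dec-true (proj₁ p ≟ₙ proj₁ q) eq))) λ()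
    joined⇒≡ : ∀ p q c → joined τ p q ≡ true → edge c (proj₁ p) ≡ edge c (proj₁ q) → bits τ p c ≡ bits τ q c
    joined⇒≡ p q c adjacent eq = unxor (bits τ p c) (bits τ q c) (trans (sym (cong (λ b → not b ∨ not (bits τ p c xor bits τ q c))
        (dec-true (edge c (proj₁ p) Fin.≟ edge c (proj₁ q)) eq))) (parts c))
      where
      unxor : ∀ a b → not (a xor b) ≡ true → a ≡ b
      unxor true  true  _ = refl
      unxor false false _ = refl
      ∧-true : ∀ a {b} → a ∧ b ≡ true → a ≡ true × b ≡ true
      ∧-true true eq = refl , eq
      all-parts : consistent τ p q 0F ≡ true × (consistent τ p q 1F ∧ consistent τ p q 2F) ≡ true
      all-parts = ∧-true (consistent τ p q 0F) (proj₂ (∧-true (not (point (proj₁ p) (proj₁ q))) adjacent))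
      parts : ∀ c → consistent τ p q c ≡ true
      parts 0F = proj₁ all-parts
      parts 1F = proj₁ (∧-true (consistent τ p q 1F) (proj₂ all-parts))
      parts 2F = proj₂ (∧-true (consistent τ p q 1F) (proj₂ all-parts))
    over-injective : ∀ {u v} → node (image-of u) ≡ node (image-of v) → u ≡ v
    over-injective {u} {v} eq with u ≟ₙ v
    ... | yes u≡v = u≡v
    ... | no  u≢v = contradiction eq (joined⇒≢ (Inverse.to coordinates (image-of u)) (Inverse.to coordinates (image-of v)) (clique u≢v))
    -- Adjacent vertices lie over distinct nodes, so the 2M images of the clique hit every node
    -- exactly once.
    over : ∀ y → ∃ λ u → node (image-of u) ≡ y
    over = Node-injective⇒surjective (node ∘ image-of) over-injective
    choice : Node M → Node M × (Bool × Bool)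
    choice y = Inverse.to coordinates (image-of (proj₁ (over y)))
    choice-over : ∀ y → proj₁ (choice y) ≡ y
    choice-over y = proj₂ (over y)
    choice-agree : ∀ {u v} c → u ≢ v → edge c u ≡ edge c v → bits τ (choice u) c ≡ bits τ (choice v) c
    choice-agree {u} {v} c u≢v eq = joined⇒≡ (choice u) (choice v) c
      (clique (λ same → u≢v (trans (sym (choice-over u)) (trans (cong (node ∘ image-of) same) (choice-over v)))))
      (trans (cong (edge c) (choice-over u)) (trans eq (cong (edge c) (sym (choice-over v)))))
    -- Each edge reads its bit at its left end; by adjacency in the clique the right end carries the
    -- same bit, so the boundary of `D` at a node is the sum of its three bits, the charge.
    D : Chain
    D c i = bits τ (choice (left i)) c
    D-bits : ∀ u c → D c (edge c u) ≡ bits τ (choice u) c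
    D-bits (left i)  c = refl
    D-bits (right j) c = choice-agree c (λ ()) refl
    bits-sum : ∀ p → bits τ p 0F xor (bits τ p 1F xor bits τ p 2F) ≡ τ (proj₁ p)
    bits-sum (u , x , y) = cancel x y (τ u)
      where
      cancel : ∀ x y t → x xor (y xor (x xor (y xor t))) ≡ t
      cancel true  true  t = trans (Bool.not-involutive _) (Bool.not-involutive t)
      cancel true  false t = Bool.not-involutive t
      cancel false true  t = Bool.not-involutive t
      cancel false false t = refl
    ∂D : ∀ u → ∂ D u ≡ τ u
    ∂D u = trans (cong₂ _xor_ (D-bits u 0F) (cong₂ _xor_ (D-bits u 1F) (D-bits u 2F)))
      (trans (bits-sum (choice u)) (cong τ (choice-over u)))

-- Vertex numbering and the choice of parameters.

coordinates : ∀ M → Fin (M * 8) ↔ (Node M × (Bool × Bool))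
coordinates M = ×-assoc′ ↔-∘ ((↔-id (Fin M) ×-↔ three-bits) ↔-∘ Fin.*↔× {M} {8})
  where
  two-bits : Fin 4 ↔ (Bool × Bool)
  two-bits = (Fin.2↔Bool ×-↔ Fin.2↔Bool) ↔-∘ Fin.*↔× {2} {2}
  three-bits : Fin 8 ↔ (Bool × (Bool × Bool))
  three-bits = (Fin.2↔Bool ×-↔ two-bits) ↔-∘ Fin.*↔× {2} {4}
  ×-assoc′ : (Fin M × (Bool × (Bool × Bool))) ↔ (Node M × (Bool × Bool))
  ×-assoc′ = mk↔ₛ′ (λ (i , b , xy) → (i , b) , xy) (λ ((i , b) , xy) → i , b , xy) (λ _ → refl) (λ _ → refl)

theorem36 : Σ ℕ λ n₀ → ∀ (n : ℕ) → n₀ ≤ n → 8 ∣ n →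
    Σ (Graph n) λ G → Σ (Graph n) λ H →
    ¬ Iso G H × (∀ (k : ℕ) → 1 ≤ k → 96 * (k + 1) < n → WLEquiv k G H)
-- 864 = 8 · 108, where 108 = 12 · 9 is the least M covered by `expander-exists`.
theorem36 = 864 , graphs
  where
  graphs : ∀ n → 864 ≤ n → 8 ∣ n → Σ (Graph n) λ G → Σ (Graph n) λ H →
    ¬ Iso G H × (∀ k → 1 ≤ k → 96 * (k + 1) < n → WLEquiv k G H)
  graphs n 864≤n (divides M refl) = from-expander (expander-exists M 108≤M)
    where
    108≤M : 108 ≤ M
    108≤M = *-cancelʳ-≤ 108 M 8 864≤n
    from-expander : (∃ λ (π : Fin 3 → Permutation′ M) → BaseGraph.Expander π) → Σ (Graph n) λ G → Σ (Graph n) λ H →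
      ¬ Iso G H × (∀ k → 1 ≤ k → 96 * (k + 1) < n → WLEquiv k G H)
    from-expander (π , expander) = from-haven (BaseGraph.haven π expander [] (≤-trans (s≤s z≤n) 108≤M))
      where
      from-haven : (∃ λ t → BaseGraph.Big π [] t) → Σ (Graph n) λ G → Σ (Graph n) λ H →
        ¬ Iso G H × (∀ k → 1 ≤ k → 96 * (k + 1) < n → WLEquiv k G H)
      -- The charge is put at a node that is big for the empty list, so that `initial` can lead it
      -- to every later safe component.
      from-haven (t₀ , big₀) = G , H , cfi-nonisomorphic π (coordinates M) t₀ ,
        λ k _ few → equivalent k (*-cancelʳ-< 8 _ _ (≤-<-trans (≤-reflexive (scale k)) few))
        where
        open CFI.Strategy π (coordinates M) expander t₀ big₀
        scale : ∀ k → 12 * suc k * 8 ≡ 96 * (k + 1)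
        scale = solve-∀
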